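{- Let $n\ge 1$ and $0\le i,j,k\le n$. The number of permutations $\sigma\in S_n$ avoiding the pattern $321$ with $\mathrm{fp}(\sigma)=i$, $\mathrm{exc}(\sigma)=j$ and $\ell(\sigma)=k$ equals the number of permutations $\sigma\in S_n$ avoiding the pattern $132$ with $\mathrm{fp}(\sigma)=i$, $\mathrm{exc}(\sigma)=j$ and $\mathrm{rk}(\sigma)=n-k$.
   Context: A permutation $\sigma\in S_n$ contains $\pi\in S_m$ if there are indices $i_1<\dots<i_m$ with $(\sigma(i_1),\dots,\sigma(i_m))$ in the same relative order as $(\pi(1),\dots,\pi(m))$; otherwise $\sigma$ avoids $\pi$. $\mathrm{fp}(\sigma)$ is the number of $i$ with $\sigma(i)=i$ (fixed points); $\mathrm{exc}(\sigma)$ is the number of $i$ with $\sigma(i)>i$ (excedances). $\ell(\sigma)$ is the length of the longest increasing subsequence of $\sigma$. The rank $\mathrm{rk}(\sigma)$ is the largest $k\ge 0$ such that $\sigma(i)>k$ for all $i\le k$. -}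

module Defs where

open import Data.Bool using (Bool; true; false; _∧_; _∨_; not; if_then_else_)
open import Data.Nat using (ℕ; zero; suc; _+_; _⊔_; _<ᵇ_; _≡ᵇ_; _≤ᵇ_)
open import Data.Fin using (Fin; toℕ)
open import Data.Vec using (Vec; lookup)
open import Data.List using (List; []; _∷_; length; map; filterᵇ; foldr; allFin; upTo; _++_)
open import Data.Bool.ListAction using (all; any)

-- Permutations of [n] are represented in one-line notation as vectors
-- σ : Vec (Fin n) n with σ(i) = lookup σ i (0-indexed positions and values;
-- position p / value v of the paper correspond to toℕ p + 1 / toℕ v + 1).

module _ {n : ℕ} (σ : Vec (Fin n) n) where

  val : Fin n → ℕ
  val i = toℕ (lookup σ i)

  isPerm : Bool
  isPerm = all (λ a → all (λ b → (toℕ a <ᵇ toℕ b) ⇒ not (val a ≡ᵇ val b)) (allFin n)) (allFin n)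
    where
    _⇒_ : Bool → Bool → Bool
    x ⇒ y = not x ∨ y

  contains321 : Bool
  contains321 = any (λ a → any (λ b → any (λ c →
      (toℕ a <ᵇ toℕ b) ∧ (toℕ b <ᵇ toℕ c) ∧ (val b <ᵇ val a) ∧ (val c <ᵇ val b))
      (allFin n)) (allFin n)) (allFin n)

  contains132 : Bool
  contains132 = any (λ a → any (λ b → any (λ c →
      (toℕ a <ᵇ toℕ b) ∧ (toℕ b <ᵇ toℕ c) ∧ (val a <ᵇ val c) ∧ (val c <ᵇ val b))
      (allFin n)) (allFin n)) (allFin n)

  avoids321 : Bool
  avoids321 = not contains321

  avoids132 : Bool
  avoids132 = not contains132

  fp : ℕ
  fp = length (filterᵇ (λ i → val i ≡ᵇ toℕ i) (allFin n))

  exc : ℕ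
  exc = length (filterᵇ (λ i → toℕ i <ᵇ val i) (allFin n))

subsequences : {A : Set} → List A → List (List A)
subsequences [] = [] ∷ []
subsequences (x ∷ xs) = let r = subsequences xs in map (x ∷_) r ++ r

increasing : List ℕ → Bool
increasing [] = true
increasing (x ∷ []) = true
increasing (x ∷ y ∷ ys) = (x <ᵇ y) ∧ increasing (y ∷ ys)

maximum : List ℕ → ℕ
maximum = foldr _⊔_ 0

module _ {n : ℕ} (σ : Vec (Fin n) n) where

  word : List ℕ
  word = map (val σ) (allFin n)

  lis : ℕ
  lis = maximum (map length (filterᵇ increasing (subsequences word)))

  -- rank: largest k ≥ 0 such that σ(p) > k for all positions p ≤ k (1-indexed).
  -- 0-indexed: for all positions a with toℕ a < k, toℕ (σ a) + 1 > k.
  rankCond : ℕ → Bool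
  rankCond k = all (λ a → (toℕ a <ᵇ k) ⇒ (k <ᵇ suc (val σ a))) (allFin n)
    where
    _⇒_ : Bool → Bool → Bool
    x ⇒ y = not x ∨ y

  -- k ranges over 0..n (k = 0 always qualifies; k > n cannot qualify for n ≥ 1)
  rk : ℕ
  rk = maximum (filterᵇ rankCond (upTo (suc n)))

{-# OPTIONS --safe #-}

-- Both kinds of permutation are encoded by words of length n in the letters of `Step`, and the
-- statistics are read off the word.
--
-- A 132-avoider σ is determined by the lattice path below its left-to-right minima.  Follow this
-- path inward from both ends, n steps each: every step peels a column or a row off the square,
-- and the two walks meet at the corner of the Durfee square, whose side is the rank.  The state
-- (a , b) counts the entries of which only one of row and column has been peeled; 132-avoidance
-- makes the state before a step a function of the state after it and of the two turns.
--
-- A 321-avoider is determined by the sets P and V of its excedance positions and excedance values,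
-- because the excedances increase and so do the other entries.  Let e and d be the lengths of
-- the longest increasing subsequences within the first t positions and within the first t values,
-- and let h = (a + b) / 2 be the number of excedances open at t.  Then d + b = e + h and
-- e + a = d + h.  A deficient position changes e into max (e , d - h + 1), so e grows exactly
-- when b = 0; dually an excedance value lets d grow exactly when a = 0.  Comparing with the
-- letters, e grows at exactly the steps at which the walk of σ does not turn.
--
-- Forward, the state, P and V determine the turns.  Hence the 132-avoiders inject into the
-- 321-avoiders, with fp and exc kept and rank r sent to longest length n - r.  Since the
-- Simion–Schmidt map injects 321-avoiders into 132-avoiders, finiteness makes this a bijection.
module Submission where

open import Defs
open import Data.Bool using (Bool; true; false; not; if_then_else_; _∨_; T; T?)
import Data.Bool as Bool
import Data.Bool.Properties as Bool
open import Data.Bool.ListAction using (all; any)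
open import Data.Nat
open import Data.Nat.Properties
open import Data.Nat.Induction using (<-rec)
open import Data.Nat.Tactic.RingSolver using (solve-∀)
open import Data.Fin using (Fin; toℕ; fromℕ<; funToFin; finToFun)
import Data.Fin as Fin
open import Data.Fin.Properties
  using (toℕ<n; toℕ-fromℕ<; fromℕ<-toℕ; toℕ-injective; pigeonhole; finToFun-funToFin)
open import Data.Vec using (Vec; lookup; tabulate)
open import Data.Vec.Properties using (lookup∘tabulate; tabulate∘lookup; tabulate-cong)
open import Data.List using (List; []; _∷_; length; map; filterᵇ; allFin; upTo; applyUpTo)
import Data.List as List
open import Data.List.Properties using (map-tabulate)
open import Data.List.Membership.Propositional using (_∈_)
open import Data.List.Membership.Propositional.Properties
open import Data.List.Relation.Unary.Any using (here; there)
open import Data.Product using (Σ; _×_; _,_; proj₁; proj₂; ∃)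
open import Data.Sum using (_⊎_; inj₁; inj₂; [_,_]′)
open import Data.Empty using (⊥; ⊥-elim)
open import Function using (_∘_; id; case_of_)
open import Function.Bundles using (_↔_; mk↔ₛ′)
open import Axiom.UniquenessOfIdentityProofs using (module Decidable⇒UIP)
open import Relation.Nullary using (¬_; Dec; yes; no; does; contradiction; ¬?)
open import Relation.Nullary.Decidable using (_×-dec_; _⊎-dec_; dec-true; dec-false; decidable-stable)
open import Relation.Binary.Definitions using (tri<; tri≈; tri>)
open import Relation.Binary.PropositionalEquality hiding (J)

-- Counting

⟦_⟧ : Bool → ℕ
⟦ true ⟧  = 1
⟦ false ⟧ = 0

cnt : {P : ℕ → Set} → (∀ p → Dec (P p)) → ℕ → ℕ
cnt P? zero    = 0
cnt P? (suc n) = ⟦ does (P? n) ⟧ + cnt P? n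

cnt-yes : {P : ℕ → Set} (P? : ∀ p → Dec (P p)) {n : ℕ} → P n → cnt P? (suc n) ≡ suc (cnt P? n)
cnt-yes P? {n} pn rewrite dec-true (P? n) pn = refl

cnt-no : {P : ℕ → Set} (P? : ∀ p → Dec (P p)) {n : ℕ} → ¬ P n → cnt P? (suc n) ≡ cnt P? n
cnt-no P? {n} ¬pn rewrite dec-false (P? n) ¬pn = refl

cnt-ext : {P Q : ℕ → Set} (P? : ∀ p → Dec (P p)) (Q? : ∀ p → Dec (Q p)) (n : ℕ) →
  (∀ p → p < n → P p → Q p) → (∀ p → p < n → Q p → P p) → cnt P? n ≡ cnt Q? n
cnt-ext P? Q? zero    f g = refl
cnt-ext P? Q? (suc n) f g with P? n | Q? n
... | yes _ | yes _ = cong suc (cnt-ext P? Q? n (λ p p<n → f p (m<n⇒m<1+n p<n)) (λ p p<n → g p (m<n⇒m<1+n p<n)))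
... | no _  | no _  = cnt-ext P? Q? n (λ p p<n → f p (m<n⇒m<1+n p<n)) (λ p p<n → g p (m<n⇒m<1+n p<n))
... | yes a | no b  = contradiction (f n ≤-refl a) b
... | no a  | yes b = contradiction (g n ≤-refl b) a

cnt-point : {P Q : ℕ → Set} (P? : ∀ p → Dec (P p)) (Q? : ∀ p → Dec (Q p)) (n k : ℕ) → k < n → P k → ¬ Q k →
  (∀ p → p < n → p ≢ k → P p → Q p) → (∀ p → p < n → Q p → P p) → cnt P? n ≡ suc (cnt Q? n)
cnt-point P? Q? (suc n) k k<n pk ¬qk f g with n ≟ k
... | yes refl = trans (cnt-yes P? pk) (cong suc (trans
        (cnt-ext P? Q? n (λ p p<n → f p (m<n⇒m<1+n p<n) (<⇒≢ p<n)) (λ p p<n → g p (m<n⇒m<1+n p<n)))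
        (sym (cnt-no Q? ¬qk))))
... | no n≢k = step
  where
  rec : cnt P? n ≡ suc (cnt Q? n)
  rec = cnt-point P? Q? n k (≤∧≢⇒< (≤-pred k<n) (n≢k ∘ sym)) pk ¬qk
          (λ p p<n → f p (m<n⇒m<1+n p<n)) (λ p p<n → g p (m<n⇒m<1+n p<n))
  step : cnt P? (suc n) ≡ suc (cnt Q? (suc n))
  step with P? n | Q? n
  ... | yes _ | yes _ = cong suc rec
  ... | no _  | no _  = rec
  ... | yes a | no b  = contradiction (f n ≤-refl n≢k a) b
  ... | no a  | yes b = contradiction (g n ≤-refl b) a

-- Pigeonhole by induction on `n`: when `n` satisfies `P`, it is dropped together with its image,
-- and `cnt-point` accounts for the value removed from `Q`.
cnt-injection : {P Q : ℕ → Set} (P? : ∀ p → Dec (P p)) (Q? : ∀ p → Dec (Q p)) (n m : ℕ) (h : ℕ → ℕ) →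
  (∀ p → p < n → P p → h p < m × Q (h p)) →
  (∀ p q → p < n → q < n → P p → P q → h p ≡ h q → p ≡ q) → cnt P? n ≤ cnt Q? m
cnt-injection P? Q? zero    m h into inj = z≤n
cnt-injection {P} {Q} P? Q? (suc n) m h into inj with P? n
... | no _   = cnt-injection P? Q? n m h (λ p p<n → into p (m<n⇒m<1+n p<n))
                 (λ p q p<n q<n → inj p q (m<n⇒m<1+n p<n) (m<n⇒m<1+n q<n))
... | yes pn = subst (suc (cnt P? n) ≤_) (sym removed) (s≤s rec)
  where
  Q′? : ∀ q → Dec (Q q × q ≢ h n)
  Q′? q = Q? q ×-dec ¬? (q ≟ h n)
  removed : cnt Q? m ≡ suc (cnt Q′? m)
  removed = cnt-point Q? Q′? m (h n) (proj₁ (into n ≤-refl pn)) (proj₂ (into n ≤-refl pn)) (λ z → proj₂ z refl)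
              (λ p _ p≢ qp → qp , p≢) (λ p _ → proj₁)
  rec : cnt P? n ≤ cnt Q′? m
  rec = cnt-injection P? Q′? n m h
          (λ p p<n pp → proj₁ (into p (m<n⇒m<1+n p<n) pp) , proj₂ (into p (m<n⇒m<1+n p<n) pp) ,
             λ e → <⇒≢ p<n (inj p n (m<n⇒m<1+n p<n) ≤-refl pp pn e))
          (λ p q p<n q<n → inj p q (m<n⇒m<1+n p<n) (m<n⇒m<1+n q<n))

cnt-mono : {P Q : ℕ → Set} (P? : ∀ p → Dec (P p)) (Q? : ∀ p → Dec (Q p)) (n : ℕ) →
  (∀ p → p < n → P p → Q p) → cnt P? n ≤ cnt Q? n
cnt-mono P? Q? n f = cnt-injection P? Q? n n id (λ p p<n pp → p<n , f p p<n pp) (λ _ _ _ _ _ _ e → e)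

cnt-split : {P Q : ℕ → Set} (P? : ∀ p → Dec (P p)) (Q? : ∀ p → Dec (Q p)) (n : ℕ) →
  cnt P? n ≡ cnt (λ p → P? p ×-dec Q? p) n + cnt (λ p → P? p ×-dec ¬? (Q? p)) n
cnt-split P? Q? zero    = refl
cnt-split P? Q? (suc n) with P? n | Q? n
... | yes _ | yes _ = cong suc (cnt-split P? Q? n)
... | yes _ | no _  = trans (cong suc (cnt-split P? Q? n)) (sym (+-suc _ _))
... | no _  | yes _ = cnt-split P? Q? n
... | no _  | no _  = cnt-split P? Q? n

cnt-complement : {P : ℕ → Set} (P? : ∀ p → Dec (P p)) (n : ℕ) → cnt P? n + cnt (¬? ∘ P?) n ≡ n
cnt-complement P? zero    = refl
cnt-complement P? (suc n) with P? n
... | yes _ = cong suc (cnt-complement P? n)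
... | no _  = trans (+-suc _ _) (cong suc (cnt-complement P? n))

cnt-full : {P : ℕ → Set} (P? : ∀ p → Dec (P p)) (n : ℕ) → (∀ p → p < n → P p) → cnt P? n ≡ n
cnt-full P? zero    f = refl
cnt-full P? (suc n) f = trans (cnt-yes P? (f n ≤-refl)) (cong suc (cnt-full P? n (λ p p<n → f p (m<n⇒m<1+n p<n))))

cnt-empty : {P : ℕ → Set} (P? : ∀ p → Dec (P p)) (n : ℕ) → (∀ p → p < n → ¬ P p) → cnt P? n ≡ 0
cnt-empty P? zero    f = refl
cnt-empty P? (suc n) f = trans (cnt-no P? (f n ≤-refl)) (cnt-empty P? n (λ p p<n → f p (m<n⇒m<1+n p<n)))

cnt-suc-≤ : {P : ℕ → Set} (P? : ∀ p → Dec (P p)) (n : ℕ) → cnt P? (suc n) ≤ suc (cnt P? n)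
cnt-suc-≤ P? n with P? n
... | yes _ = ≤-refl
... | no _  = n≤1+n _

cnt-≤-cnt : {P : ℕ → Set} (P? : ∀ p → Dec (P p)) {m n : ℕ} → m ≤ n → cnt P? m ≤ cnt P? n
cnt-≤-cnt P? {m} {n} m≤n = cnt-injection P? P? m n id (λ p p<m pp → <-≤-trans p<m m≤n , pp) (λ _ _ _ _ _ _ e → e)

cnt-<-cnt : {P : ℕ → Set} (P? : ∀ p → Dec (P p)) {m n : ℕ} → m < n → P m → cnt P? m < cnt P? n
cnt-<-cnt P? {m} {n} m<n pm = subst (_≤ cnt P? n) (cnt-yes P? pm) (cnt-≤-cnt P? m<n)

select : {P : ℕ → Set} (P? : ∀ p → Dec (P p)) (n r : ℕ) → r < cnt P? n → ∃ λ q → q < n × P q × cnt P? q ≡ r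
select P? (suc n) r r<c with P? n | r ≟ cnt P? n
... | yes pn | yes refl = n , ≤-refl , pn , refl
... | yes _  | no r≢    = let q , q<n , pq , e = select P? n r (≤∧≢⇒< (≤-pred r<c) r≢) in q , m<n⇒m<1+n q<n , pq , e
... | no _   | _        = let q , q<n , pq , e = select P? n r r<c in q , m<n⇒m<1+n q<n , pq , e

cnt-injective : {P : ℕ → Set} (P? : ∀ p → Dec (P p)) {m n : ℕ} → P m → P n → cnt P? m ≡ cnt P? n → m ≡ n
cnt-injective P? {m} {n} pm pn e with <-cmp m n
... | tri< m<n _ _ = contradiction e (<⇒≢ (cnt-<-cnt P? m<n pm))
... | tri≈ _ e′ _  = e′
... | tri> _ _ n<m = contradiction (sym e) (<⇒≢ (cnt-<-cnt P? n<m pn))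

cnt-<-cancel : {P : ℕ → Set} (P? : ∀ p → Dec (P p)) {m n : ℕ} → cnt P? m < cnt P? n → m < n
cnt-<-cancel P? {m} {n} lt with m <? n
... | yes m<n = m<n
... | no m≮n  = contradiction (cnt-≤-cnt P? (≮⇒≥ m≮n)) (<⇒≱ lt)

-- Functions on ℕ, constrained only below `n`. The inverse is carried along because rows and columns
-- are treated alike: what is shown for `σ` is also applied to `τ`.
record IsPermutation (n : ℕ) (σ τ : ℕ → ℕ) : Set where
  field
    σ<  : ∀ {p} → p < n → σ p < n
    τ<  : ∀ {q} → q < n → τ q < n
    τσ  : ∀ {p} → p < n → τ (σ p) ≡ p
    στ  : ∀ {q} → q < n → σ (τ q) ≡ q

  σ-injective : ∀ {p q} → p < n → q < n → σ p ≡ σ q → p ≡ q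
  σ-injective p<n q<n e = trans (sym (τσ p<n)) (trans (cong τ e) (τσ q<n))

inverse : ∀ {n σ τ} → IsPermutation n σ τ → IsPermutation n τ σ
inverse π = record { σ< = τ< ; τ< = σ< ; τσ = στ ; στ = τσ } where open IsPermutation π

Avoids132 : ℕ → (ℕ → ℕ) → Set
Avoids132 n σ = ∀ {a b c} → a < b → b < c → c < n → σ a < σ c → σ c < σ b → ⊥

Avoids321 : ℕ → (ℕ → ℕ) → Set
Avoids321 n σ = ∀ {a b c} → a < b → b < c → c < n → σ b < σ a → σ c < σ b → ⊥

-- 132 is an involution: exchanging positions and values in an occurrence for `τ` gives one for `σ`,
-- with the last two entries interchanged.
inverse-avoids132 : ∀ {n σ τ} → IsPermutation n σ τ → Avoids132 n σ → Avoids132 n τ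
inverse-avoids132 {n} {σ} {τ} π av {a} {b} {c} a<b b<c c<n τa<τc τc<τb =
  av τa<τc τc<τb (τ< b<n) (subst₂ _<_ (sym (στ a<n)) (sym (στ b<n)) a<b) (subst₂ _<_ (sym (στ b<n)) (sym (στ c<n)) b<c)
  where
  open IsPermutation π
  b<n : b < n
  b<n = <-trans b<c c<n
  a<n : a < n
  a<n = <-trans a<b b<n

-- Letters of a lattice word, taking the state (a , b) to (a′ , b′).  For the 321-avoider, P and V
-- mark an excedance position and an excedance value; for the 132-avoider, X and Y mark a turn
-- of the walk of σ and of its inverse.  G marks a fixed point of both.
data Step : (a b a′ b′ : ℕ) (P V X Y G : Bool) → Set where
  open-both    : ∀ {a b} → Step a b (suc a) (suc b) true false false false false
  exc-exc      : ∀ {a b} → Step (suc a) b a (suc b) true true false true false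
  exc-exc-lost : ∀ {b} → Step 0 (suc b) 0 (suc b) true true false false false
  def-def      : ∀ {a b} → Step a (suc b) (suc a) b false false true false false
  def-def-lost : ∀ {a} → Step (suc a) 0 (suc a) 0 false false false false false
  close-both   : ∀ {a b} → Step (suc a) (suc b) a b false true true true false
  close-lost-a : ∀ {b} → Step 0 (suc (suc b)) 0 b false true true false false
  close-lost-b : ∀ {a} → Step (suc (suc a)) 0 a 0 false true false true false
  fixed        : Step 0 0 0 0 false false false false true

∸-step : ∀ {t n} → t < n → n ∸ t ≡ suc (n ∸ suc t)
∸-step {zero}  {suc n} _   = refl
∸-step {suc t} {suc n} t<n = ∸-step (≤-pred t<n)

-- Reading a 132-avoiding permutation

-- The path separating the cells (p , q) with q below all of f 0, …, f p from the others, followed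
-- inward from its end at value n: after t steps it has crossed `walk t` columns and the rows from
-- `top t` on; it turns to cross a column when the entry of that column lies in a crossed row.
-- Following it from the other end amounts to the walk of the inverse permutation.
module Walk (n : ℕ) (f : ℕ → ℕ) where

  mutual
    walk : ℕ → ℕ
    walk zero    = 0
    walk (suc t) = ⟦ does (turn? t) ⟧ + walk t

    top : ℕ → ℕ
    top t = walk t + (n ∸ t)

    Turn : ℕ → Set
    Turn t = top t ≤ f (walk t)

    turn? : ∀ t → Dec (Turn t)
    turn? t = top t ≤? f (walk t)

  walk-turn : ∀ t → Turn t → walk (suc t) ≡ suc (walk t)
  walk-turn t x rewrite dec-true (turn? t) x = refl

  walk-stay : ∀ t → ¬ Turn t → walk (suc t) ≡ walk t
  walk-stay t x rewrite dec-false (turn? t) x = refl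

  top-turn : ∀ {t} → t < n → Turn t → top (suc t) ≡ top t
  top-turn {t} t<n x rewrite dec-true (turn? t) x | ∸-step t<n = sym (+-suc _ _)

  top-stay : ∀ {t} → t < n → ¬ Turn t → top t ≡ suc (top (suc t))
  top-stay {t} t<n x rewrite dec-false (turn? t) x | ∸-step t<n = +-suc _ _

  walk≤ : ∀ t → walk t ≤ t
  walk≤ zero    = z≤n
  walk≤ (suc t) with turn? t
  ... | yes x = ≤-trans (≤-reflexive (walk-turn t x)) (s≤s (walk≤ t))
  ... | no x  = ≤-trans (≤-reflexive (walk-stay t x)) (m≤n⇒m≤1+n (walk≤ t))

  walk≤-suc : ∀ t → walk t ≤ walk (suc t)
  walk≤-suc t = m≤n+m _ _

  walk-mono : ∀ {t t′} → t ≤ t′ → walk t ≤ walk t′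
  walk-mono {t} {t′} t≤t′ with m≤n⇒m<n∨m≡n t≤t′
  ... | inj₂ refl = ≤-refl
  walk-mono {t} {suc t′} _ | inj₁ t<t′ = ≤-trans (walk-mono (≤-pred t<t′)) (walk≤-suc t′)

  top-suc≤ : ∀ {t} → t < n → top (suc t) ≤ top t
  top-suc≤ {t} t<n with turn? t
  ... | yes x = ≤-reflexive (top-turn t<n x)
  ... | no x  = ≤-trans (n≤1+n _) (≤-reflexive (sym (top-stay t<n x)))

  top-antitone : ∀ {t t′} → t ≤ t′ → t′ ≤ n → top t′ ≤ top t
  top-antitone {t} {t′} t≤t′ t′≤n with m≤n⇒m<n∨m≡n t≤t′
  ... | inj₂ refl = ≤-refl
  top-antitone {t} {suc t′} _ t′<n | inj₁ t<t′ = ≤-trans (top-suc≤ t′<n) (top-antitone (≤-pred t<t′) (<⇒≤ t′<n))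

  top≤n : ∀ {t} → t ≤ n → top t ≤ n
  top≤n t≤n = top-antitone z≤n t≤n

  top<n-stay : ∀ {t} → t < n → ¬ Turn t → top (suc t) < n
  top<n-stay t<n x = ≤-trans (≤-reflexive (sym (top-stay t<n x))) (top≤n (<⇒≤ t<n))

  walk<n : ∀ {t} → t < n → walk t < n
  walk<n {t} t<n = ≤-<-trans (walk≤ t) t<n

  top-end : top n ≡ walk n
  top-end = trans (cong (walk n +_) (n∸n≡0 n)) (+-identityʳ _)

  above : ∀ t → t ≤ n → ∀ {p} → p < walk t → top t ≤ f p
  above (suc t) t<n {p} p< with turn? t
  ... | no x  = ≤-trans (top-suc≤ t<n) (above t (<⇒≤ t<n) (subst (p <_) (walk-stay t x) p<))
  ... | yes x = ≤-trans (≤-reflexive (top-turn t<n x)) below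
    where
    below : top t ≤ f p
    below with m≤n⇒m<n∨m≡n {p} {walk t} (≤-pred (subst (p <_) (walk-turn t x) p<))
    ... | inj₁ p<w  = above t (<⇒≤ t<n) p<w
    ... | inj₂ refl = x

  -- The last row was crossed because the entry of the current column lay in none of the rows
  -- crossed before; turns made since then have not changed `top`.
  low-point : ∀ t → t ≤ n → top t < n → ∃ λ q → q ≤ walk t × f q ≤ top t
  low-point zero    _   top<n = contradiction top<n (n≮n n)
  low-point (suc t) t<n top<n with turn? t
  ... | yes x = let q , q≤ , fq≤ = low-point t (<⇒≤ t<n) (subst (_< n) (top-turn t<n x) top<n)
                in q , ≤-trans q≤ (walk≤-suc t) , ≤-trans fq≤ (≤-reflexive (sym (top-turn t<n x)))
  ... | no x  = walk t , walk≤-suc t , ≤-pred (subst (f (walk t) <_) (top-stay t<n x) (≰⇒> x))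

  find-top : ∀ T → T ≤ n → ∀ {q} → top T ≤ q → q < n → ∃ λ t → t < T × ¬ Turn t × top (suc t) ≡ q
  find-top zero    _   top≤q q<n = contradiction q<n (≤⇒≯ top≤q)
  find-top (suc T) T<n {q} top≤q q<n with top T ≤? q | turn? T
  ... | yes top≤ | _ = let t , t<T , rest = find-top T (<⇒≤ T<n) top≤ q<n in t , m<n⇒m<1+n t<T , rest
  ... | no top≰ | yes x = contradiction (subst (_≤ q) (top-turn T<n x) top≤q) top≰
  ... | no top≰ | no x  = T , ≤-refl , x , ≤-antisym top≤q (≤-pred (subst (suc q ≤_) (top-stay T<n x) (≰⇒> top≰)))

  find-walk : ∀ T {p} → p < walk T → ∃ λ t → t < T × Turn t × walk t ≡ p
  find-walk (suc T) {p} p< with p <? walk T | turn? T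
  ... | yes p<w | _ = let t , t<T , rest = find-walk T p<w in t , m<n⇒m<1+n t<T , rest
  ... | no p≮w | yes x = T , ≤-refl , x , ≤-antisym (≮⇒≥ p≮w) (≤-pred (subst (p <_) (walk-turn T x) p<))
  ... | no p≮w | no x  = contradiction (subst (p <_) (walk-stay T x) p<) p≮w

  walk-cnt : ∀ t → walk t ≡ cnt turn? t
  walk-cnt zero    = refl
  walk-cnt (suc t) = cong (⟦ does (turn? t) ⟧ +_) (walk-cnt t)

  -- While fewer than `k` columns are crossed, the current entry is at least `k`, so crossing a row
  -- leaves `top` at least `k`; in the end `top n` and `walk n` coincide. Since `above` gives the
  -- rank condition for `walk n` itself, the rank is `walk n`.
  rank-maximal : ∀ {k} → k ≤ n → (∀ p → p < k → k ≤ f p) → k ≤ walk n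
  rank-maximal {k} k≤n cond = [ id , (λ k≤top → ≤-trans k≤top (≤-reflexive top-end)) ]′ (go n ≤-refl)
    where
    go : ∀ t → t ≤ n → k ≤ walk t ⊎ k ≤ top t
    go zero    _   = inj₂ k≤n
    go (suc t) t<n with go t (<⇒≤ t<n) | k ≤? walk t
    ... | inj₁ k≤w | _       = inj₁ (≤-trans k≤w (walk≤-suc t))
    ... | inj₂ _   | yes k≤w = inj₁ (≤-trans k≤w (walk≤-suc t))
    ... | inj₂ k≤top | no k≰w = inj₂ (new (turn? t))
      where
      new : Dec (Turn t) → k ≤ top (suc t)
      new (yes x) = ≤-trans k≤top (≤-reflexive (sym (top-turn t<n x)))
      new (no x)  = ≤-pred (≤-trans (s≤s (cond (walk t) (≰⇒> k≰w)))
                      (≤-trans (≰⇒> x) (≤-reflexive (top-stay t<n x))))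

cnt-from : {P : ℕ → Set} (P? : ∀ p → Dec (P p)) (k m : ℕ) → (∀ p → p < m → P p → k ≤ p) → cnt P? m ≤ m ∸ k
cnt-from P? k zero    f = z≤n
cnt-from P? k (suc m) f with P? m
... | yes pm = ≤-trans (s≤s (cnt-from P? k m (λ p p<m → f p (m<n⇒m<1+n p<m))))
                 (≤-reflexive (sym (+-∸-assoc 1 (f m ≤-refl pm))))
... | no _   = ≤-trans (cnt-from P? k m (λ p p<m → f p (m<n⇒m<1+n p<m))) (∸-monoˡ-≤ k (n≤1+n m))

-- After t steps the positions in [i , j) and the values in [w , v) remain; b counts the
-- entries in a remaining position whose value has been peeled off at the top.
module Half {n : ℕ} {σ τ : ℕ → ℕ} (π : IsPermutation n σ τ) (av : Avoids132 n σ) where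
  open IsPermutation π
  open Walk n σ using () renaming (walk to i; top to v; Turn to X; turn? to X?)
  open Walk n τ using () renaming (walk to w; top to j; Turn to Y; turn? to Y?)
  module R = Walk n σ
  module C = Walk n τ

  Over : ℕ → ℕ → Set
  Over t p = i t ≤ p × v t ≤ σ p

  over? : ∀ t p → Dec (Over t p)
  over? t p = (i t ≤? p) ×-dec (v t ≤? σ p)

  b : ℕ → ℕ
  b t = cnt (over? t) (j t)

  -- Suppose `l ≤ i t`. The low point of the inverse walk then has a position `τ q ≤ i t`, and all
  -- columns up to `i t` have values at least `v t`; but `q ≤ w t ≤ l ≤ i t < v t`. Consequently a
  -- turn crosses a column that the inverse walk has not peeled.
  turn-left-of : ∀ {t} → t < n → X t → ∀ l → w t ≤ l → (l < n → ∃ λ q → q ≤ w t × τ q ≤ l) → i t < l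
  turn-left-of {t} t<n x l w≤l low = ≰⇒> absurd
    where
    absurd : l ≤ i t → ⊥
    absurd l≤i with low (≤-<-trans l≤i (R.walk<n t<n))
    ... | q , q≤w , τq≤l = <⇒≱ q<v v≤q
      where
      v≤ : ∀ {p} → p ≤ i t → v t ≤ σ p
      v≤ {p} p≤i with m≤n⇒m<n∨m≡n p≤i
      ... | inj₁ p<i  = R.above t (<⇒≤ t<n) p<i
      ... | inj₂ refl = x
      v≤q : v t ≤ q
      v≤q = subst (v t ≤_) (στ (≤-<-trans q≤w (C.walk<n t<n))) (v≤ (≤-trans τq≤l l≤i))
      q<v : q < v t
      q<v = ≤-<-trans (≤-trans q≤w (≤-trans w≤l l≤i))
              (≤-trans (s≤s (m≤m+n (i t) (n ∸ suc t))) (≤-reflexive (sym (trans (cong (i t +_) (∸-step t<n)) (+-suc _ _)))))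

  w≤j : ∀ t → w t ≤ j t
  w≤j t = m≤m+n (w t) (n ∸ t)

  turn-inside : ∀ {t} → t < n → X t → i t < j t
  turn-inside {t} t<n x = turn-left-of t<n x (j t) (w≤j t) (C.low-point t (<⇒≤ t<n))

  turn-inside′ : ∀ {t} → t < n → X t → i t < j (suc t)
  turn-inside′ {t} t<n x with Y? t
  ... | yes y = subst (i t <_) (sym (C.top-turn t<n y)) (turn-inside t<n x)
  ... | no ¬y = turn-left-of t<n x (j (suc t)) (subst (_≤ j (suc t)) (C.walk-stay t ¬y) (w≤j (suc t)))
                  (λ l<n → let q , q≤ , r = C.low-point (suc t) t<n l<n in q , subst (q ≤_) (C.walk-stay t ¬y) q≤ , r)

  j≤n : ∀ {t} → t ≤ n → j t ≤ n
  j≤n = C.top≤n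

  first≤ : ∀ {t} → t < n → ¬ X t → σ (i t) ≤ v (suc t)
  first≤ t<n ¬x = ≤-pred (≤-trans (≰⇒> ¬x) (≤-reflexive (R.top-stay t<n ¬x)))

  i≤τv : ∀ {t} → t < n → ¬ X t → i t ≤ τ (v (suc t))
  i≤τv {t} t<n ¬x = ≮⇒≥ λ lt → <⇒≱ {v (suc t)} {v t} (≤-reflexive (sym (R.top-stay t<n ¬x)))
    (subst (v t ≤_) (στ (R.top<n-stay t<n ¬x)) (R.above t (<⇒≤ t<n) lt))

  -- The path has already turned below the value v(t+1), so the first remaining entry makes
  -- any larger entry to the left of that value the start of a 132.
  before-v : ∀ {t} → t < n → ¬ X t → ∀ {p} → i t ≤ p → p < τ (v (suc t)) → σ p < v (suc t)
  before-v {t} t<n ¬x {p} i≤p p<τv = ≰⇒> absurd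
    where
    V = v (suc t)
    V<n = R.top<n-stay t<n ¬x
    absurd : V ≤ σ p → ⊥
    absurd V≤σp with m≤n⇒m<n∨m≡n V≤σp
    ... | inj₂ V≡ = <⇒≢ p<τv (sym (trans (cong τ V≡) (τσ (<-trans p<τv (τ< V<n)))))
    ... | inj₁ V<σp with m≤n⇒m<n∨m≡n i≤p
    ...   | inj₂ refl = <⇒≱ V<σp (first≤ t<n ¬x)
    ...   | inj₁ i<p with m≤n⇒m<n∨m≡n (first≤ t<n ¬x)
    ...     | inj₂ σi≡V = <⇒≢ (<-trans i<p p<τv) (trans (sym (τσ (<-trans i<p (<-trans p<τv (τ< V<n))))) (cong τ σi≡V))
    ...     | inj₁ σi<V = av i<p p<τv (τ< V<n) (subst (σ (i t) <_) (sym (στ V<n)) σi<V)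
                            (subst (_< σ p) (sym (στ V<n)) V<σp)

  reached⇒b>0 : ∀ {t} → t < n → ¬ X t → τ (v (suc t)) < j (suc t) → 0 < b (suc t)
  reached⇒b>0 {t} t<n ¬x lt = ≤-<-trans z≤n (cnt-<-cnt (over? (suc t)) lt
    (subst (_≤ τ (v (suc t))) (sym (R.walk-stay t ¬x)) (i≤τv t<n ¬x) , ≤-reflexive (sym (στ (R.top<n-stay t<n ¬x)))))

  -- All remaining positions are then to the left of the value `v (suc t)`, where `before-v` keeps
  -- the entries small. With `reached⇒b>0`, whether `b (suc t)` vanishes tells on which side of
  -- `j (suc t)` that value stands.
  unreached⇒b≡0 : ∀ {t} → t < n → ¬ X t → ¬ τ (v (suc t)) < j (suc t) → b (suc t) ≡ 0
  unreached⇒b≡0 {t} t<n ¬x ≮ = cnt-empty (over? (suc t)) (j (suc t)) λ p p<j (i≤p , v≤σp) →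
    <⇒≱ (before-v t<n ¬x (subst (_≤ p) (R.walk-stay t ¬x) i≤p) (<-≤-trans p<j (≮⇒≥ ≮))) v≤σp

  -- The step is taken in two halves: from `b t` to `middle t` only `j` moves, from `middle t` to
  -- `b (suc t)` only `i` and `v`.
  middle : ℕ → ℕ
  middle t = cnt (over? t) (j (suc t))

  middle-turn : ∀ {t} → t < n → X t → middle t ≡ suc (b (suc t))
  middle-turn {t} t<n x = cnt-point (over? t) (over? (suc t)) (j (suc t)) (i t) (turn-inside′ t<n x)
    (≤-refl , x) (λ (i′≤i , _) → n≮n (i t) (subst (_≤ i t) (R.walk-turn t x) i′≤i))
    (λ p _ p≢ (i≤p , v≤) → subst (_≤ p) (sym (R.walk-turn t x)) (≤∧≢⇒< i≤p (p≢ ∘ sym)) , subst (_≤ σ p) (sym (R.top-turn t<n x)) v≤)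
    (λ p _ (i′≤p , v≤) → ≤-trans (n≤1+n _) (subst (_≤ p) (R.walk-turn t x) i′≤p) , subst (_≤ σ p) (R.top-turn t<n x) v≤)

  over-stay : ∀ {t} → t < n → ¬ X t → ∀ p → p < j (suc t) → Over t p → Over (suc t) p
  over-stay {t} t<n ¬x p _ (i≤p , v≤) = subst (_≤ p) (sym (R.walk-stay t ¬x)) i≤p , ≤-trans (R.top-suc≤ t<n) v≤

  -- Crossing a row adds its entry to the count if that entry is in a remaining column. Otherwise
  -- both counts are zero by `unreached⇒b≡0`, and `pred` covers this case too.
  middle-stay : ∀ {t} → t < n → ¬ X t → middle t ≡ pred (b (suc t))
  middle-stay {t} t<n ¬x with τ (v (suc t)) <? j (suc t)
  ... | yes lt = sym (cong pred (cnt-point (over? (suc t)) (over? t) (j (suc t)) (τ (v (suc t))) lt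
    (subst (_≤ τ (v (suc t))) (sym (R.walk-stay t ¬x)) (i≤τv t<n ¬x) , ≤-reflexive (sym στv))
    (λ (_ , v≤) → n≮n (v (suc t)) (subst₂ _≤_ (R.top-stay t<n ¬x) στv v≤))
    (λ p p<j p≢ (i≤p , v≤) → subst (_≤ p) (R.walk-stay t ¬x) i≤p , subst (_≤ σ p) (sym (R.top-stay t<n ¬x))
       (≤∧≢⇒< v≤ λ e → p≢ (trans (sym (τσ (<-≤-trans p<j (j≤n t<n)))) (cong τ (sym e)))))
    (over-stay t<n ¬x)))
    where
    στv = στ (R.top<n-stay t<n ¬x)
  ... | no ≮ = trans (n≤0⇒n≡0 (≤-trans (cnt-mono (over? t) (over? (suc t)) (j (suc t)) (over-stay t<n ¬x))
                 (≤-reflexive b≡0))) (cong pred (sym b≡0))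
    where
    b≡0 = unreached⇒b≡0 t<n ¬x ≮

  b-Y : ∀ {t} → t < n → Y t → b t ≡ middle t
  b-Y {t} t<n y = cong (cnt (over? t)) (sym (C.top-turn t<n y))

  b-¬Y-over : ∀ {t} → t < n → ¬ Y t → Over t (j (suc t)) → b t ≡ suc (middle t)
  b-¬Y-over {t} t<n ¬y o = trans (cong (cnt (over? t)) (C.top-stay t<n ¬y)) (cnt-yes (over? t) o)

  b-¬Y-under : ∀ {t} → t < n → ¬ Y t → ¬ Over t (j (suc t)) → b t ≡ middle t
  b-¬Y-under {t} t<n ¬y o = trans (cong (cnt (over? t)) (C.top-stay t<n ¬y)) (cnt-no (over? t) o)

  -- The two peeled lines carry the same entry when nothing overhangs.
  corner : ∀ {t} → t < n → ¬ X t → ¬ Y t → ¬ τ (v (suc t)) < j (suc t) → ¬ σ (j (suc t)) < v (suc t) →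
    σ (j (suc t)) ≡ v (suc t)
  corner {t} t<n ¬x ¬y τv≮j σj≮v with m≤n⇒m<n∨m≡n (≮⇒≥ τv≮j)
  ... | inj₂ j≡τv = trans (cong σ j≡τv) (στ (R.top<n-stay t<n ¬x))
  ... | inj₁ j<τv = contradiction (before-v t<n ¬x i≤j j<τv) σj≮v
    where
    J = j (suc t)
    τw≤J : τ (w t) ≤ J
    τw≤J = ≤-pred (≤-trans (≰⇒> ¬y) (≤-reflexive (C.top-stay t<n ¬y)))
    w≤J : w t ≤ J
    w≤J = subst (_≤ J) (C.walk-stay t ¬y) (w≤j (suc t))
    i≤j : i t ≤ J
    i≤j = ≮⇒≥ λ J<i → <⇒≱ {w t} {v t} (≤-<-trans w≤J (<-≤-trans J<i (m≤m+n (i t) (n ∸ t))))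
            (subst (v t ≤_) (στ (C.walk<n t<n)) (R.above t (<⇒≤ t<n) (≤-<-trans τw≤J J<i)))

-- The state before a step, from the state after it and the two turns; swapping the
-- arguments in pairs gives the other component.
outer : (a′ b′ : ℕ) (x y : Bool) → ℕ
outer a′       b′ true  true  = suc b′
outer zero     b′ true  false = suc (suc b′)
outer (suc a′) b′ true  false = suc b′
outer a′       b′ false true  = pred b′
outer zero     b′ false false = b′
outer (suc a′) b′ false false = pred b′

isExc : ℕ → Bool → Bool
isExc (suc _) false = true
isExc _       _     = false

isFixed : (a′ b′ : ℕ) (x y : Bool) → Bool
isFixed zero zero false false = true
isFixed _    _    _     _     = false

isExcᵥ : (a′ b′ : ℕ) (x y : Bool) → Bool
isExcᵥ a′       b′       x     true  = true
isExcᵥ (suc a′) b′       x     false = false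
isExcᵥ zero     zero     false false = false
isExcᵥ zero     (suc b′) false false = true
isExcᵥ zero     b′       true  false = true

isExcᵥ-positive : ∀ {a′ b′ x y} → 0 < a′ → y ≡ false → isExcᵥ a′ b′ x y ≡ false
isExcᵥ-positive (s≤s _) refl = refl

isFixed-positive : ∀ {a′ b′ x y} → 0 < a′ → isFixed a′ b′ x y ≡ false
isFixed-positive (s≤s _) = refl

fixed-letter : ∀ {a′ b′ x y} → a′ ≡ 0 → b′ ≡ 0 → x ≡ false → y ≡ false →
  isExcᵥ a′ b′ x y ≡ false × isFixed a′ b′ x y ≡ true
fixed-letter refl refl refl refl = refl , refl

isExcᵥ-intro : ∀ {a′ b′ x y} → a′ ≡ 0 → y ≡ false → (x ≡ false → 0 < b′) → isExcᵥ a′ b′ x y ≡ true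
isExcᵥ-intro {b′ = zero}  {true}  refl refl _ = refl
isExcᵥ-intro {b′ = suc _} {true}  refl refl _ = refl
isExcᵥ-intro {b′ = zero}  {false} refl refl f = contradiction (f refl) (n≮n 0)
isExcᵥ-intro {b′ = suc _} {false} refl refl _ = refl

isExcᵥ⇒¬isFixed : ∀ a′ b′ x y → isExcᵥ a′ b′ x y ≡ true → isFixed a′ b′ x y ≡ false
isExcᵥ⇒¬isFixed zero    zero    true  true  _ = refl
isExcᵥ⇒¬isFixed zero    zero    true  false _ = refl
isExcᵥ⇒¬isFixed zero    zero    false true  _ = refl
isExcᵥ⇒¬isFixed zero    (suc _) _     _     _ = refl
isExcᵥ⇒¬isFixed (suc _) _       _     _     _ = refl

-- Sixteen cases: each component of the state after the step is zero or positive, and each walk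
-- turns or not. They produce all nine letters.
backward-step : ∀ a′ b′ x y →
  Step (outer b′ a′ y x) (outer a′ b′ x y) a′ b′ (isExc b′ x) (isExcᵥ a′ b′ x y) x y (isFixed a′ b′ x y)
backward-step zero    zero    true  true  = close-both
backward-step zero    (suc _) true  true  = close-both
backward-step (suc _) zero    true  true  = close-both
backward-step (suc _) (suc _) true  true  = close-both
backward-step zero    zero    true  false = close-lost-a
backward-step zero    (suc _) true  false = close-lost-a
backward-step (suc _) zero    true  false = def-def
backward-step (suc _) (suc _) true  false = def-def
backward-step zero    zero    false true  = close-lost-b
backward-step (suc _) zero    false true  = close-lost-b
backward-step zero    (suc _) false true  = exc-exc
backward-step (suc _) (suc _) false true  = exc-exc
backward-step zero    zero    false false = fixed
backward-step zero    (suc _) false false = exc-exc-lost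
backward-step (suc _) zero    false false = def-def-lost
backward-step (suc _) (suc _) false false = open-both

shift-out : ∀ b i → suc (suc b) + (i + i) ≡ b + (suc i + suc i)
shift-out = solve-∀

-- The invariant counts the entries in remaining rows and columns twice:
-- `(j - i) - b = (v - w) - a`, where `j = w + (n - t)` and `v = i + (n - t)`. Here it is carried
-- along letter by letter.
step-balance : ∀ {a b a′ b′ P V X Y G} → Step a b a′ b′ P V X Y G → ∀ i w →
  b + (i + i) ≡ a + (w + w) →
  b′ + ((⟦ X ⟧ + i) + (⟦ X ⟧ + i)) ≡ a′ + ((⟦ Y ⟧ + w) + (⟦ Y ⟧ + w))
step-balance open-both                        i w e = cong suc e
step-balance {a′ = a} exc-exc                 i w e = trans (cong suc e) (shift-out a w)
step-balance exc-exc-lost                     i w e = e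
step-balance {b = suc b} def-def              i w e = trans (sym (shift-out b i)) (cong suc e)
step-balance def-def-lost                     i w e = e
step-balance {a = suc a} {b = suc b} close-both i w e = trans (sym (shift-out b i)) (trans (cong suc e) (shift-out a w))
step-balance {b′ = b} close-lost-a            i w e = trans (sym (shift-out b i)) e
step-balance {a′ = a} close-lost-b            i w e = trans e (shift-out a w)
step-balance fixed                            i w e = e

-- Doubling the bound gives `2b + 2i ≤ 2w ≤ a + 2w = b + 2i`. The bound arises when the `b`
-- overhanging entries share at most `w - i` positions.
surplus⇒0 : ∀ {a b i w} → b + (i + i) ≡ a + (w + w) → b + i ≤ w → b ≡ 0
surplus⇒0 {a} {b} {i} {w} e le = n≤0⇒n≡0 (+-cancelʳ-≤ (b + (i + i)) b 0 (begin
  b + (b + (i + i))   ≡⟨ lem b i ⟩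
  (b + i) + (b + i)   ≤⟨ +-mono-≤ le le ⟩
  w + w               ≤⟨ m≤n+m (w + w) a ⟩
  a + (w + w)         ≡⟨ sym e ⟩
  b + (i + i)         ∎))
  where
  open ≤-Reasoning
  lem : ∀ b i → b + (b + (i + i)) ≡ (b + i) + (b + i)
  lem = solve-∀

does-≟true : ∀ z → does (z Bool.≟ true) ≡ z
does-≟true true  = refl
does-≟true false = refl

module Avoider {n : ℕ} {σ τ : ℕ → ℕ} (π : IsPermutation n σ τ) (av : Avoids132 n σ) where
  open IsPermutation π
  module A = Half π av
  module B = Half (inverse π) (inverse-avoids132 π av)
  open Walk n σ using () renaming (walk to i; top to v; Turn to X; turn? to X?)
  open Walk n τ using () renaming (walk to w; top to j; Turn to Y; turn? to Y?)
  module R = Walk n σ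
  module C = Walk n τ

  a b : ℕ → ℕ
  a = B.b
  b = A.b

  x y P V G : ℕ → Bool
  x t = does (X? t)
  y t = does (Y? t)
  P t = isExc (b (suc t)) (x t)
  V t = isExcᵥ (a (suc t)) (b (suc t)) (x t) (y t)
  G t = isFixed (a (suc t)) (b (suc t)) (x t) (y t)

  -- Once the turns are known, it matters only whether the entries of the newly peeled column `J`
  -- and row `N` lie among the remaining rows and columns. By `reached⇒b>0` and `unreached⇒b≡0` for
  -- both walks, the state after the step shows this. Exchanging `σ` and `τ` gives the other
  -- component.
  b-outer : ∀ {t} → t < n → b t ≡ outer (a (suc t)) (b (suc t)) (x t) (y t)
  b-outer {t} t<n = go (X? t) (Y? t)
    where
    J = j (suc t)
    N = v (suc t)
    Goal : Set
    Goal = b t ≡ outer (a (suc t)) (b (suc t)) (x t) (y t)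

    conclude : ∀ {a₀ b₀ x₀ y₀} → a (suc t) ≡ a₀ → b (suc t) ≡ b₀ → x t ≡ x₀ → y t ≡ y₀ →
      b t ≡ outer a₀ b₀ x₀ y₀ → Goal
    conclude {x₀ = x₀} {y₀} ea eb ex ey e =
      trans e (sym (trans (cong₂ (outer (a (suc t)) (b (suc t))) ex ey) (cong₂ (λ α β → outer α β x₀ y₀) ea eb)))

    positive : ∀ {k} → 0 < k → k ≡ suc (pred k)
    positive (s≤s _) = refl

    go : Dec (X t) → Dec (Y t) → Goal
    go (yes xx) (yes yy) = conclude refl refl (dec-true (X? t) xx) (dec-true (Y? t) yy)
      (trans (A.b-Y t<n yy) (A.middle-turn t<n xx))
    go (no ¬xx) (yes yy) = conclude refl refl (dec-false (X? t) ¬xx) (dec-true (Y? t) yy)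
      (trans (A.b-Y t<n yy) (A.middle-stay t<n ¬xx))
    go (yes xx) (no ¬yy) with σ J <? N
    ... | no σj≮v = conclude (B.unreached⇒b≡0 t<n ¬yy σj≮v) refl (dec-true (X? t) xx) (dec-false (Y? t) ¬yy)
          (trans (A.b-¬Y-over t<n ¬yy (<⇒≤ (A.turn-inside′ t<n xx) , subst (_≤ σ J) (R.top-turn t<n xx) (≮⇒≥ σj≮v)))
            (cong suc (A.middle-turn t<n xx)))
    ... | yes σj<v = conclude (positive (B.reached⇒b>0 t<n ¬yy σj<v)) refl (dec-true (X? t) xx) (dec-false (Y? t) ¬yy)
          (trans (A.b-¬Y-under t<n ¬yy λ (_ , v≤) → <⇒≱ σj<v (subst (_≤ σ J) (sym (R.top-turn t<n xx)) v≤))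
            (A.middle-turn t<n xx))
    go (no ¬xx) (no ¬yy) with σ J <? N | τ N <? J
    ... | yes σj<v | _ = conclude (positive (B.reached⇒b>0 t<n ¬yy σj<v)) refl (dec-false (X? t) ¬xx) (dec-false (Y? t) ¬yy)
          (trans (A.b-¬Y-under t<n ¬yy λ (_ , v≤) → <⇒≱ σj<v (≤-trans (R.top-suc≤ t<n) v≤)) (A.middle-stay t<n ¬xx))
    -- Column `J` and row `N` share their entry by `corner`, so it did not overhang before the step.
    ... | no σj≮v | no τv≮j = conclude (B.unreached⇒b≡0 t<n ¬yy σj≮v) b≡0 (dec-false (X? t) ¬xx) (dec-false (Y? t) ¬yy)
          (trans (A.b-¬Y-under t<n ¬yy λ (_ , v≤) →
             n≮n N (subst₂ _≤_ (R.top-stay t<n ¬xx) (A.corner t<n ¬xx ¬yy τv≮j σj≮v) v≤))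
            (trans (A.middle-stay t<n ¬xx) (cong pred b≡0)))
      where
      b≡0 = A.unreached⇒b≡0 t<n ¬xx τv≮j
    ... | no σj≮v | yes τv<j = conclude (B.unreached⇒b≡0 t<n ¬yy σj≮v) b>0 (dec-false (X? t) ¬xx) (dec-false (Y? t) ¬yy)
          (trans (A.b-¬Y-over t<n ¬yy (≤-trans (A.i≤τv t<n ¬xx) (<⇒≤ τv<j) ,
             subst (_≤ σ J) (sym (R.top-stay t<n ¬xx)) (≤∧≢⇒< (≮⇒≥ σj≮v)
               λ e → <⇒≢ τv<j (trans (cong τ e) (τσ (C.top<n-stay t<n ¬yy))))))
            (cong suc (A.middle-stay t<n ¬xx)))
      where
      b>0 = positive (A.reached⇒b>0 t<n ¬xx τv<j)

module Reading {n : ℕ} {σ τ : ℕ → ℕ} (π : IsPermutation n σ τ) (av : Avoids132 n σ) where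
  open IsPermutation π
  open Avoider π av public
  module D = Avoider (inverse π) (inverse-avoids132 π av)
  open Walk n σ using () renaming (walk to i; top to v; Turn to X; turn? to X?)
  open Walk n τ using () renaming (walk to w; top to j; Turn to Y; turn? to Y?)

  step : ∀ t → t < n → Step (a t) (b t) (a (suc t)) (b (suc t)) (P t) (V t) (x t) (y t) (G t)
  step t t<n = subst₂ (λ a₀ b₀ → Step a₀ b₀ (a (suc t)) (b (suc t)) (P t) (V t) (x t) (y t) (G t))
    (sym (D.b-outer t<n)) (sym (b-outer t<n)) (backward-step (a (suc t)) (b (suc t)) (x t) (y t))

  b-start : b 0 ≡ 0
  b-start = cnt-empty (A.over? 0) n λ p p<n (_ , n≤σp) → <⇒≱ (σ< p<n) n≤σp

  a-start : a 0 ≡ 0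
  a-start = cnt-empty (B.over? 0) n λ q q<n (_ , n≤τq) → <⇒≱ (τ< q<n) n≤τq

  balance : ∀ t → t ≤ n → b t + (i t + i t) ≡ a t + (w t + w t)
  balance zero    _   = cong (_+ 0) (trans b-start (sym a-start))
  balance (suc t) t<n = step-balance (step t t<n) (i t) (w t) (balance t (<⇒≤ t<n))

  -- Otherwise `v (suc t) ≤ τ (v (suc t))`. By `before-v` the entries counted by `b (suc t)` stand
  -- from that position on, so they number at most `j - v = w - i`, and the balance makes
  -- `b (suc t)` vanish, against `reached⇒b>0`.
  reached⇒exc : ∀ {t} → t < n → ¬ X t → τ (v (suc t)) < j (suc t) → τ (v (suc t)) < v (suc t)
  reached⇒exc {t} t<n ¬x lt = ≰⇒> λ v≤τv → n≮n 0 (subst (0 <_) (b≡0 v≤τv) b>0)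
    where
    s′ = n ∸ suc t
    b>0 = A.reached⇒b>0 t<n ¬x lt
    b≤ : v (suc t) ≤ τ (v (suc t)) → b (suc t) ≤ w (suc t) ∸ i (suc t)
    b≤ v≤τv = begin
      b (suc t)                            ≤⟨ cnt-from (A.over? (suc t)) (τ (v (suc t))) (j (suc t)) (λ p _ (i≤p , v≤σp) →
                                                ≮⇒≥ λ p< → <⇒≱ (A.before-v t<n ¬x (subst (_≤ p) (A.R.walk-stay t ¬x) i≤p) p<) v≤σp) ⟩
      j (suc t) ∸ τ (v (suc t))            ≤⟨ ∸-monoʳ-≤ (j (suc t)) v≤τv ⟩
      j (suc t) ∸ v (suc t)                ≡⟨ cong₂ _∸_ (+-comm (w (suc t)) s′) (+-comm (i (suc t)) s′) ⟩
      (s′ + w (suc t)) ∸ (s′ + i (suc t))  ≡⟨ [m+n]∸[m+o]≡n∸o s′ (w (suc t)) (i (suc t)) ⟩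
      w (suc t) ∸ i (suc t)                ∎
      where open ≤-Reasoning
    b≡0 : v (suc t) ≤ τ (v (suc t)) → b (suc t) ≡ 0
    b≡0 v≤τv = surplus⇒0 {a (suc t)} (balance (suc t) t<n) (m≤o∸n⇒m+n≤o (b (suc t)) i≤w (b≤ v≤τv))
      where
      i≤w : i (suc t) ≤ w (suc t)
      i≤w = <⇒≤ (m∸n≢0⇒n<m λ e → n≮n 0 (<-≤-trans b>0 (≤-trans (b≤ v≤τv) (≤-reflexive e))))

double-injective : ∀ {m n} → m + m ≡ n + n → m ≡ n
double-injective {m} {n} e with <-cmp m n
... | tri< m<n _ _ = contradiction e (<⇒≢ (+-mono-< m<n m<n))
... | tri≈ _ e′ _  = e′
... | tri> _ _ n<m = contradiction (sym e) (<⇒≢ (+-mono-< n<m n<m))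

-- Excedances and fixed points of the 132-avoider

module Statistics {n : ℕ} {σ τ : ℕ → ℕ} (π : IsPermutation n σ τ) (av : Avoids132 n σ) where
  open IsPermutation π
  open Reading π av public
  module D′ = Reading (inverse π) (inverse-avoids132 π av)
  open Walk n σ using () renaming (walk to i; top to v; Turn to X; turn? to X?)
  open Walk n τ using () renaming (walk to w; top to j; Turn to Y; turn? to Y?)

  -- If the row of the entry in column `J` still remains, the dual of `reached⇒exc` makes `J`
  -- deficient. If that row is crossed in the same step, nothing overhangs, so the balance gives
  -- `i = w`, hence `v = j` and a fixed point. If it was crossed at an earlier step `t′`, column `J`
  -- was still present then, and `reached⇒exc` at `t′` makes `J` an excedance.
  classify : ∀ t → t < n → ¬ Y t → V t ≡ does (j (suc t) <? σ (j (suc t))) × G t ≡ does (σ (j (suc t)) ≟ j (suc t))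
  classify t t<n ¬y with σ (j (suc t)) <? v (suc t)
  ... | yes σj<v = trans V≡ (sym (dec-false (J <? σ J) (<⇒≯ σj<j))) , trans G≡ (sym (dec-false (σ J ≟ J) (<⇒≢ σj<j)))
    where
    J = j (suc t)
    σj<j : σ J < J
    σj<j = D′.reached⇒exc t<n ¬y σj<v
    V≡ : V t ≡ false
    V≡ = isExcᵥ-positive (B.reached⇒b>0 t<n ¬y σj<v) (dec-false (Y? t) ¬y)
    G≡ : G t ≡ false
    G≡ = isFixed-positive (B.reached⇒b>0 t<n ¬y σj<v)
  ... | no σj≮v with R.find-top (suc t) t<n (≮⇒≥ σj≮v) (σ< (C.top<n-stay t<n ¬y))
  ...   | t′ , t′<1+t , ¬x′ , v≡ with m≤n⇒m<n∨m≡n (≤-pred t′<1+t)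
  ...     | inj₂ refl = trans V≡ (sym (dec-false (J <? σ J) (λ lt → <⇒≢ lt (sym σj≡j)))) , trans G≡ (sym (dec-true (σ J ≟ J) σj≡j))
    where
    J = j (suc t)
    a≡0 : a (suc t) ≡ 0
    a≡0 = B.unreached⇒b≡0 t<n ¬y σj≮v
    b≡0 : b (suc t) ≡ 0
    b≡0 = A.unreached⇒b≡0 t<n ¬x′ (λ lt → <⇒≢ lt (trans (cong τ v≡) (τσ (C.top<n-stay t<n ¬y))))
    V≡ : V t ≡ false
    V≡ = proj₁ (fixed-letter a≡0 b≡0 (dec-false (X? t) ¬x′) (dec-false (Y? t) ¬y))
    G≡ : G t ≡ true
    G≡ = proj₂ (fixed-letter a≡0 b≡0 (dec-false (X? t) ¬x′) (dec-false (Y? t) ¬y))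
    σj≡j : σ J ≡ J
    σj≡j = trans (sym v≡) (cong (_+ (n ∸ suc t)) (double-injective
      (subst₂ (λ β α → β + (i (suc t) + i (suc t)) ≡ α + (w (suc t) + w (suc t))) b≡0 a≡0 (balance (suc t) t<n))))
  ...     | inj₁ t′<t = trans V≡ (sym (dec-true (J <? σ J) j<σj)) , trans G≡ (sym (dec-false (σ J ≟ J) (≢-sym (<⇒≢ j<σj))))
    where
    J = j (suc t)
    t′<n = <-trans t′<t t<n
    a≡0 : a (suc t) ≡ 0
    a≡0 = B.unreached⇒b≡0 t<n ¬y σj≮v
    τv≡J : τ (v (suc t′)) ≡ J
    τv≡J = trans (cong τ v≡) (τσ (C.top<n-stay t<n ¬y))
    J<j : J < j (suc t′)
    J<j = ≤-trans (≤-reflexive (sym (C.top-stay t<n ¬y))) (C.top-antitone t′<t (<⇒≤ t<n))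
    j<σj : J < σ J
    j<σj = subst₂ _<_ τv≡J v≡ (reached⇒exc t′<n ¬x′ (subst (_< j (suc t′)) (sym τv≡J) J<j))
    b>0 : ¬ X t → 0 < b (suc t)
    b>0 ¬x with τ (v (suc t)) <? J
    ... | yes lt = A.reached⇒b>0 t<n ¬x lt
    ... | no τv≮ = contradiction (trans (sym (A.corner t<n ¬x ¬y τv≮ σj≮v)) (sym v≡))
                   (<⇒≢ (≤-trans (≤-reflexive (sym (R.top-stay t<n ¬x))) (R.top-antitone t′<t (<⇒≤ t<n))))
    V≡ : V t ≡ true
    V≡ = isExcᵥ-intro a≡0 (dec-false (Y? t) ¬y) λ x≡false →
      b>0 λ xx → case trans (sym x≡false) (dec-true (X? t) xx) of λ ()
    G≡ : G t ≡ false
    G≡ = isExcᵥ⇒¬isFixed (a (suc t)) (b (suc t)) (x t) (y t) V≡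

  V-turn : ∀ t → Y t → V t ≡ true
  V-turn t yy = excᵥ (dec-true (Y? t) yy)
    where
    excᵥ : ∀ {a′ b′ x y} → y ≡ true → isExcᵥ a′ b′ x y ≡ true
    excᵥ refl = refl

  G-turn : ∀ t → Y t → G t ≡ false
  G-turn t yy = isExcᵥ⇒¬isFixed (a (suc t)) (b (suc t)) (x t) (y t) (V-turn t yy)

  -- After `n` steps the columns left are `[i n , w n)` and the rows left `[w n , i n)`, so at least
  -- one range is empty. The component of the empty range vanishes outright, the other by
  -- `surplus⇒0`; then the balance equates `i n` and `w n`.
  final : b n ≡ 0 × a n ≡ 0 × i n ≡ w n
  final with ≤-total (i n) (w n)
  ... | inj₁ i≤w = b≡0 , a≡0 , double-injective (subst₂ (λ β α → β + (i n + i n) ≡ α + (w n + w n)) b≡0 a≡0 (balance n ≤-refl))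
    where
    b≡0 : b n ≡ 0
    b≡0 = surplus⇒0 {a n} (balance n ≤-refl) (m≤o∸n⇒m+n≤o (b n) i≤w (≤-trans
      (cnt-from (A.over? n) (i n) (j n) (λ _ _ → proj₁)) (≤-reflexive (cong (_∸ i n) C.top-end))))
    a≡0 : a n ≡ 0
    a≡0 = n≤0⇒n≡0 (≤-trans (cnt-from (B.over? n) (w n) (v n) (λ _ _ → proj₁))
      (≤-reflexive (trans (cong (_∸ w n) R.top-end) (m≤n⇒m∸n≡0 i≤w))))
  ... | inj₂ w≤i = b≡0 , a≡0 , double-injective (subst₂ (λ β α → β + (i n + i n) ≡ α + (w n + w n)) b≡0 a≡0 (balance n ≤-refl))
    where
    a≡0 : a n ≡ 0
    a≡0 = surplus⇒0 {b n} (sym (balance n ≤-refl)) (m≤o∸n⇒m+n≤o (a n) w≤i (≤-trans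
      (cnt-from (B.over? n) (w n) (v n) (λ _ _ → proj₁)) (≤-reflexive (cong (_∸ w n) R.top-end))))
    b≡0 : b n ≡ 0
    b≡0 = n≤0⇒n≡0 (≤-trans (cnt-from (A.over? n) (i n) (j n) (λ _ _ → proj₁))
      (≤-reflexive (trans (cong (_∸ i n) C.top-end) (m≤n⇒m∸n≡0 w≤i))))

  Exc : ℕ → Set
  Exc p = p < σ p

  exc? : ∀ p → Dec (Exc p)
  exc? p = p <? σ p

  fix? : ∀ p → Dec (σ p ≡ p)
  fix? p = σ p ≟ p

  -- Columns leave from the right at steps where the inverse walk does not turn, and `classify`
  -- applies to them. At its turns no column leaves although `V` is true, and `w t` compensates; in
  -- `exc≡` this term cancels against the first `w n` columns, all of them excedances.
  exc-count : ∀ t → t ≤ n → cnt exc? n + w t ≡ cnt exc? (j t) + cnt (λ s → V s Bool.≟ true) t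
  exc-count zero    _   = refl
  exc-count (suc t) t<n with Y? t
  ... | yes yy = begin
    cnt exc? n + w (suc t)       ≡⟨ cong (cnt exc? n +_) (C.walk-turn t yy) ⟩
    cnt exc? n + suc (w t)       ≡⟨ +-suc _ _ ⟩
    suc (cnt exc? n + w t)       ≡⟨ cong suc (exc-count t (<⇒≤ t<n)) ⟩
    suc (cnt exc? (j t) + #V t)  ≡⟨ sym (+-suc _ _) ⟩
    cnt exc? (j t) + suc (#V t)  ≡⟨ cong₂ (λ l c → cnt exc? l + c) (sym (C.top-turn t<n yy)) (sym (cnt-yes (λ s → V s Bool.≟ true) {t} (V-turn t yy))) ⟩
    cnt exc? (j (suc t)) + #V (suc t) ∎
    where
    open ≡-Reasoning
    #V = cnt (λ s → V s Bool.≟ true)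
  ... | no ¬yy = begin
    cnt exc? n + w (suc t)                               ≡⟨ cong (cnt exc? n +_) (C.walk-stay t ¬yy) ⟩
    cnt exc? n + w t                                     ≡⟨ exc-count t (<⇒≤ t<n) ⟩
    cnt exc? (j t) + #V t                                ≡⟨ cong (λ l → cnt exc? l + #V t) (C.top-stay t<n ¬yy) ⟩
    ⟦ does (exc? J) ⟧ + cnt exc? J + #V t                ≡⟨ cong (λ z → ⟦ z ⟧ + cnt exc? J + #V t) (sym (proj₁ (classify t t<n ¬yy))) ⟩
    ⟦ V t ⟧ + cnt exc? J + #V t                          ≡⟨ cong (_+ #V t) (+-comm ⟦ V t ⟧ _) ⟩
    cnt exc? J + ⟦ V t ⟧ + #V t                          ≡⟨ +-assoc (cnt exc? J) _ _ ⟩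
    cnt exc? J + (⟦ V t ⟧ + #V t)                        ≡⟨ cong (λ z → cnt exc? J + (⟦ z ⟧ + #V t)) (sym (does-≟true (V t))) ⟩
    cnt exc? J + #V (suc t)                              ∎
    where
    open ≡-Reasoning
    #V = cnt (λ s → V s Bool.≟ true)
    J = j (suc t)

  fix-count : ∀ t → t ≤ n → cnt fix? n ≡ cnt fix? (j t) + cnt (λ s → G s Bool.≟ true) t
  fix-count zero    _   = sym (+-identityʳ _)
  fix-count (suc t) t<n with Y? t
  ... | yes yy = trans (fix-count t (<⇒≤ t<n)) (cong₂ (λ l c → cnt fix? l + c) (sym (C.top-turn t<n yy))
                   (sym (cnt-no (λ s → G s Bool.≟ true) {t} λ g → case trans (sym g) (G-turn t yy) of λ ())))
  ... | no ¬yy = begin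
    cnt fix? n                                           ≡⟨ fix-count t (<⇒≤ t<n) ⟩
    cnt fix? (j t) + #G t                                ≡⟨ cong (λ l → cnt fix? l + #G t) (C.top-stay t<n ¬yy) ⟩
    ⟦ does (fix? J) ⟧ + cnt fix? J + #G t                ≡⟨ cong (λ z → ⟦ z ⟧ + cnt fix? J + #G t) (sym (proj₂ (classify t t<n ¬yy))) ⟩
    ⟦ G t ⟧ + cnt fix? J + #G t                          ≡⟨ cong (_+ #G t) (+-comm ⟦ G t ⟧ _) ⟩
    cnt fix? J + ⟦ G t ⟧ + #G t                          ≡⟨ +-assoc (cnt fix? J) _ _ ⟩
    cnt fix? J + (⟦ G t ⟧ + #G t)                        ≡⟨ cong (λ z → cnt fix? J + (⟦ z ⟧ + #G t)) (sym (does-≟true (G t))) ⟩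
    cnt fix? J + #G (suc t)                              ∎
    where
    open ≡-Reasoning
    #G = cnt (λ s → G s Bool.≟ true)
    J = j (suc t)

  exc≡ : cnt exc? n ≡ cnt (λ s → V s Bool.≟ true) n
  exc≡ = +-cancelʳ-≡ (w n) _ _ (trans (exc-count n ≤-refl) (trans (+-comm (cnt exc? (j n)) _) (cong (cnt (λ s → V s Bool.≟ true) n +_)
    (trans (cong (cnt exc?) C.top-end) (cnt-full exc? (w n) λ p p<w → let p<i = subst (p <_) (sym (proj₂ (proj₂ final))) p<w in
      <-≤-trans p<i (≤-trans (≤-reflexive (sym R.top-end)) (R.above n ≤-refl p<i)))))))

  fix≡ : cnt fix? n ≡ cnt (λ s → G s Bool.≟ true) n
  fix≡ = trans (fix-count n ≤-refl) (cong (_+ cnt (λ s → G s Bool.≟ true) n)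
    (trans (cong (cnt fix?) C.top-end) (cnt-empty fix? (w n) λ p p<w e → let p<i = subst (p <_) (sym (proj₂ (proj₂ final))) p<w in
      <⇒≢ (<-≤-trans p<i (≤-trans (≤-reflexive (sym R.top-end)) (R.above n ≤-refl p<i))) (sym e))))

-- The turns determine a 132-avoider

module Recover {n : ℕ} {σ τ σ′ τ′ : ℕ → ℕ} (π : IsPermutation n σ τ) (π′ : IsPermutation n σ′ τ′)
  (av′ : Avoids132 n σ′) where
  open IsPermutation π
  module π′ = IsPermutation π′
  module R = Walk n σ
  module C = Walk n τ
  module R′ = Walk n σ′
  module C′ = Walk n τ′

  -- If some earlier entry is below `σ p`, the value `σ p` comes later in `σ′` and completes a 132.
  -- Otherwise `σ p` is a left-to-right minimum of `σ`, while all entries of `σ′` up to `p` exceed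
  -- it, so the paths differ at the cell `(p , σ p)`. The walk of `σ` detects this if
  -- `p < R.walk n`, the inverse walk otherwise.
  no-first-rise : (∀ t → t < n → does (R.turn? t) ≡ does (R′.turn? t)) → (∀ t → t < n → does (C.turn? t) ≡ does (C′.turn? t)) →
    R.walk n ≡ C.walk n →
    ∀ {p} → p < n → (∀ {p₀} → p₀ < p → σ p₀ ≡ σ′ p₀) → σ p < σ′ p → ⊥
  no-first-rise sameX sameY i≡w {p} p<n prefix rise with anyUpTo? (λ p₀ → σ p₀ <? σ p) p
  ... | yes (p₀ , p₀<p , lower) = av′ p₀<p p<c (π′.τ< (σ< p<n)) (subst₂ _<_ (prefix p₀<p) (sym σ′c) lower) (subst (_< σ′ p) (sym σ′c) rise)
    where
    c = τ′ (σ p)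
    σ′c : σ′ c ≡ σ p
    σ′c = π′.στ (σ< p<n)
    p<c : p < c
    p<c = ≰⇒> λ c≤p → [ (λ c<p → <⇒≢ c<p (σ-injective (<-trans c<p p<n) p<n (trans (prefix c<p) σ′c)))
                     , (λ c≡p → <⇒≢ rise (sym (trans (cong σ′ (sym c≡p)) σ′c))) ]′ (m≤n⇒m<n∨m≡n c≤p)
  ... | no none = [ upper , lower ]′ (<-≤-connex p (R.walk n))
    where
    walkR : ∀ t → t ≤ n → R.walk t ≡ R′.walk t
    walkR zero    _   = refl
    walkR (suc t) t<n = cong₂ (λ z k → ⟦ z ⟧ + k) (sameX t t<n) (walkR t (<⇒≤ t<n))
    walkC : ∀ t → t ≤ n → C.walk t ≡ C′.walk t
    walkC zero    _   = refl
    walkC (suc t) t<n = cong₂ (λ z k → ⟦ z ⟧ + k) (sameY t t<n) (walkC t (<⇒≤ t<n))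
    stay : ∀ {A B : Set} (a? : Dec A) (b? : Dec B) → does a? ≡ does b? → ¬ A → ¬ B
    stay a? b? e ¬a b = case trans (sym (dec-false a? ¬a)) (trans e (dec-true b? b)) of λ ()

    above-q : ∀ {p₀} → p₀ ≤ p → σ p < σ′ p₀
    above-q {p₀} p₀≤p with m≤n⇒m<n∨m≡n p₀≤p
    ... | inj₂ refl = rise
    ... | inj₁ p₀<p = subst (σ p <_) (prefix p₀<p) (≤∧≢⇒< (≮⇒≥ λ lt → none (p₀ , p₀<p , lt))
                        λ e → <⇒≢ p₀<p (sym (σ-injective p<n (<-trans p₀<p p<n) e)))

    -- Row `σ p` is crossed before column `p`, without a turn. As `σ′` does not turn there either,
    -- it has an entry of at most `σ p` in a column up to `p`.
    upper : p < R.walk n → ⊥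
    upper p<i with R.find-walk n p<i
    ... | t , t<n , x , refl with R.find-top t (<⇒≤ t<n) x (σ< p<n)
    ...   | t₀ , t₀<t , ¬x₀ , v≡ = <⇒≱ (above-q (≤-trans (≤-reflexive (sym (walkR t₀ (<⇒≤ t₀<n)))) (R.walk-mono (<⇒≤ t₀<t)))) (≤-pred (begin-strict
      σ′ (R′.walk t₀)  <⟨ ≰⇒> (stay (R.turn? t₀) (R′.turn? t₀) (sameX t₀ t₀<n) ¬x₀) ⟩
      R′.top t₀        ≡⟨ cong (_+ (n ∸ t₀)) (sym (walkR t₀ (<⇒≤ t₀<n))) ⟩
      R.top t₀         ≡⟨ R.top-stay t₀<n ¬x₀ ⟩
      suc (R.top (suc t₀)) ≡⟨ cong suc v≡ ⟩
      suc (σ p)        ∎))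
      where
      open ≤-Reasoning
      t₀<n = <-trans t₀<t t<n

    -- The inverse walk crosses column `p` without a turn. For `σ′` this puts the value `C.walk t`
    -- at a position up to `p`, so `σ p < C.walk t`; then `above` for `τ` says that `p` had been
    -- crossed before.
    lower : R.walk n ≤ p → ⊥
    lower i≤p with C.find-top n ≤-refl (≤-trans (≤-reflexive (trans C.top-end (sym i≡w))) i≤p) p<n
    ... | t , t<n , ¬y , j≡ = <⇒≱ {p} {C.top t} (≤-reflexive (sym (trans (C.top-stay t<n ¬y) (cong suc j≡))))
                                (subst (C.top t ≤_) (τσ p<n) (C.above t (<⇒≤ t<n) q<w))
      where
      q<w : σ p < C.walk t
      q<w = subst (σ p <_) (trans (π′.στ (subst (_< n) (walkC t (<⇒≤ t<n)) (C.walk<n t<n))) (sym (walkC t (<⇒≤ t<n))))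
              (above-q (≤-pred (begin-strict
                τ′ (C′.walk t)       <⟨ ≰⇒> (stay (C.turn? t) (C′.turn? t) (sameY t t<n) ¬y) ⟩
                C′.top t             ≡⟨ cong (_+ (n ∸ t)) (sym (walkC t (<⇒≤ t<n))) ⟩
                C.top t              ≡⟨ C.top-stay t<n ¬y ⟩
                suc (C.top (suc t))  ≡⟨ cong suc j≡ ⟩
                suc p                ∎)))
        where open ≤-Reasoning

first-difference : ∀ {n} {σ σ′ : ℕ → ℕ} →
  (∀ {p} → p < n → (∀ {p₀} → p₀ < p → σ p₀ ≡ σ′ p₀) → σ p < σ′ p → ⊥) →
  (∀ {p} → p < n → (∀ {p₀} → p₀ < p → σ p₀ ≡ σ′ p₀) → σ′ p < σ p → ⊥) →
  ∀ {p} → p < n → σ p ≡ σ′ p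
first-difference {n} {σ} {σ′} no-rise no-fall {p} p<n = <-rec (λ p → p < n → σ p ≡ σ′ p) go p p<n
  where
  go : ∀ p → (∀ {p₀} → p₀ < p → p₀ < n → σ p₀ ≡ σ′ p₀) → p < n → σ p ≡ σ′ p
  go p ih p<n with <-cmp (σ p) (σ′ p)
  ... | tri< lt _ _ = ⊥-elim (no-rise p<n (λ p₀<p → ih p₀<p (<-trans p₀<p p<n)) lt)
  ... | tri≈ _ e _  = e
  ... | tri> _ _ gt = ⊥-elim (no-fall p<n (λ p₀<p → ih p₀<p (<-trans p₀<p p<n)) gt)

turns-determine : ∀ {n σ τ σ′ τ′} → IsPermutation n σ τ → IsPermutation n σ′ τ′ → Avoids132 n σ → Avoids132 n σ′ →
  (∀ t → t < n → does (Walk.turn? n σ t) ≡ does (Walk.turn? n σ′ t)) →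
  (∀ t → t < n → does (Walk.turn? n τ t) ≡ does (Walk.turn? n τ′ t)) →
  Walk.walk n σ n ≡ Walk.walk n τ n → Walk.walk n σ′ n ≡ Walk.walk n τ′ n →
  ∀ {p} → p < n → σ p ≡ σ′ p
turns-determine π π′ av av′ sameX sameY end end′ = first-difference
  (Recover.no-first-rise π π′ av′ sameX sameY end)
  (λ p<n prefix → Recover.no-first-rise π′ π av (λ t t<n → sym (sameX t t<n)) (λ t t<n → sym (sameY t t<n)) end′ p<n
    (λ p₀<p → sym (prefix p₀<p)))

-- Decoding a word into a 321-avoiding permutation

record Word (n : ℕ) : Set where
  field
    a b       : ℕ → ℕ
    P V X Y G : ℕ → Bool
    step      : ∀ t → t < n → Step (a t) (b t) (a (suc t)) (b (suc t)) (P t) (V t) (X t) (Y t) (G t)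
    a-start   : a 0 ≡ 0
    b-start   : b 0 ≡ 0
    a-end     : a n ≡ 0
    b-end     : b n ≡ 0

-- Elements of equal colour and equal rank within the colour are matched, which gives the only
-- colour-preserving bijection that increases on each colour. With excedance positions and excedance
-- values as colours it is the 321-avoider having those sets.
module Matching (n : ℕ) (A B : ℕ → Bool)
  (equinumerous : ∀ c → cnt (λ t → A t Bool.≟ c) n ≡ cnt (λ t → B t Bool.≟ c) n) where

  #A #B : Bool → ℕ → ℕ
  #A c = cnt (λ t → A t Bool.≟ c)
  #B c = cnt (λ t → B t Bool.≟ c)

  image : ∀ {p} → p < n → ∃ λ q → q < n × B q ≡ A p × #B (A p) q ≡ #A (A p) p
  image {p} p<n = select (λ t → B t Bool.≟ A p) n (#A (A p) p)
    (subst (#A (A p) p <_) (equinumerous (A p)) (cnt-<-cnt (λ t → A t Bool.≟ A p) p<n refl))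

  match : ℕ → ℕ
  match p with p <? n
  ... | yes p<n = proj₁ (image p<n)
  ... | no _    = 0

  match-spec : ∀ {p} → p < n → match p < n × B (match p) ≡ A p × #B (A p) (match p) ≡ #A (A p) p
  match-spec {p} p<n with p <? n
  ... | yes p<n′ = proj₂ (image p<n′)
  ... | no p≮n   = contradiction p<n p≮n

  match-unique : ∀ {p q} → p < n → B q ≡ A p → #B (A p) q ≡ #A (A p) p → match p ≡ q
  match-unique {p} p<n colour rank = let _ , colour′ , rank′ = match-spec p<n in
    cnt-injective (λ t → B t Bool.≟ A p) colour′ colour (trans rank′ (sym rank))

  match-mono : ∀ {p p′} → p < p′ → p′ < n → A p ≡ A p′ → match p < match p′
  match-mono {p} {p′} p<p′ p′<n same = cnt-<-cancel (λ t → B t Bool.≟ A p) (subst₂ _<_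
    (sym (proj₂ (proj₂ (match-spec (<-trans p<p′ p′<n)))))
    (sym (subst (λ c → #B c (match p′) ≡ #A c p′) (sym same) (proj₂ (proj₂ (match-spec p′<n)))))
    (cnt-<-cnt (λ t → A t Bool.≟ A p) p<p′ refl))

match-inverse : ∀ n A B eq eq′ {p} → p < n → Matching.match n B A eq′ (Matching.match n A B eq p) ≡ p
match-inverse n A B eq eq′ {p} p<n = M′.match-unique q<n (sym colour)
  (subst (λ c → M.#A c p ≡ M.#B c (M.match p)) (sym colour) (sym rank))
  where
  module M  = Matching n A B eq
  module M′ = Matching n B A eq′
  q<n    = proj₁ (M.match-spec p<n)
  colour = proj₁ (proj₂ (M.match-spec p<n))
  rank   = proj₂ (proj₂ (M.match-spec p<n))

match-permutation : ∀ n A B eq eq′ → IsPermutation n (Matching.match n A B eq) (Matching.match n B A eq′)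
match-permutation n A B eq eq′ = record
  { σ< = λ p<n → proj₁ (Matching.match-spec n A B eq p<n)
  ; τ< = λ q<n → proj₁ (Matching.match-spec n B A eq′ q<n)
  ; τσ = match-inverse n A B eq eq′
  ; στ = match-inverse n B A eq′ eq
  }

cnt-bool : ∀ (A : ℕ → Bool) t → cnt (λ s → A s Bool.≟ true) t + cnt (λ s → A s Bool.≟ false) t ≡ t
cnt-bool A zero    = refl
cnt-bool A (suc t) with A t
... | true  = cong suc (cnt-bool A t)
... | false = trans (+-suc _ _) (cong suc (cnt-bool A t))

cnt-true : ∀ (A : ℕ → Bool) t → cnt (λ s → A s Bool.≟ true) (suc t) ≡ ⟦ A t ⟧ + cnt (λ s → A s Bool.≟ true) t
cnt-true A t = cong (λ z → ⟦ z ⟧ + cnt (λ s → A s Bool.≟ true) t) (does-≟true (A t))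

double-suc : ∀ p → suc p + suc p ≡ suc (suc (p + p))
double-suc = solve-∀

-- `p - q` is the number of open excedances; the invariant makes it half of `a + b`.
step-rank : ∀ {a b a′ b′ P V X Y G} → Step a b a′ b′ P V X Y G → ∀ p q →
  p + p ≡ q + q + (a + b) → (⟦ P ⟧ + p) + (⟦ P ⟧ + p) ≡ (⟦ V ⟧ + q) + (⟦ V ⟧ + q) + (a′ + b′)
step-rank {a} {b} open-both p q e = trans (double-suc p) (trans (cong (λ z → suc (suc z)) e) (lem q a b))
  where
  lem : ∀ q a b → suc (suc (q + q + (a + b))) ≡ q + q + (suc a + suc b)
  lem = solve-∀
step-rank {suc a} {b} exc-exc p q e = trans (double-suc p) (trans (cong (λ z → suc (suc z)) e) (lem q a b))
  where
  lem : ∀ q a b → suc (suc (q + q + (suc a + b))) ≡ suc q + suc q + (a + suc b)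
  lem = solve-∀
step-rank {b = b} exc-exc-lost p q e = trans (double-suc p) (trans (cong (λ z → suc (suc z)) e) (lem q b))
  where
  lem : ∀ q b → suc (suc (q + q + b)) ≡ suc q + suc q + b
  lem = solve-∀
step-rank {a} {suc b} def-def p q e = trans e (cong (q + q +_) (+-suc a b))
step-rank def-def-lost p q e = e
step-rank {suc a} {suc b} close-both p q e = trans e (lem q a b)
  where
  lem : ∀ q a b → q + q + (suc a + suc b) ≡ suc q + suc q + (a + b)
  lem = solve-∀
step-rank {b = suc (suc b)} close-lost-a p q e = trans e (lem q b)
  where
  lem : ∀ q b → q + q + suc (suc b) ≡ suc q + suc q + b
  lem = solve-∀
step-rank {a = suc (suc a)} close-lost-b p q e = trans e (lem q a)
  where
  lem : ∀ q a → q + q + (suc (suc a) + 0) ≡ suc q + suc q + (a + 0)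
  lem = solve-∀
step-rank fixed p q e = e

step-open : ∀ {a b a′ b′ P V X Y G} → Step a b a′ b′ P V X Y G → V ≡ true → 0 < a + b
step-open exc-exc      _ = s≤s z≤n
step-open exc-exc-lost _ = s≤s z≤n
step-open close-both   _ = s≤s z≤n
step-open close-lost-a _ = s≤s z≤n
step-open close-lost-b _ = s≤s z≤n

step-G : ∀ {a b a′ b′ P V X Y G} → Step a b a′ b′ P V X Y G → G ≡ true →
  P ≡ false × V ≡ false × a + b ≡ 0
step-G fixed _ = refl , refl , refl

step-G⁻¹ : ∀ {a b a′ b′ P V X Y G} → Step a b a′ b′ P V X Y G → P ≡ false → V ≡ false → a + b ≡ 0 → G ≡ true
step-G⁻¹ fixed _ _ _ = refl
step-G⁻¹ (def-def {zero})  _ _ ()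
step-G⁻¹ (def-def {suc _}) _ _ ()
step-G⁻¹ def-def-lost      _ _ ()

-- Letters that share `P` and `V` differ in which components of the state before the step are zero.
step-deterministic : ∀ {a b a₁ b₁ a₂ b₂ P V X₁ Y₁ G₁ X₂ Y₂ G₂} →
  Step a b a₁ b₁ P V X₁ Y₁ G₁ → Step a b a₂ b₂ P V X₂ Y₂ G₂ → (a₁ ≡ a₂ × b₁ ≡ b₂) × X₁ ≡ X₂ × Y₁ ≡ Y₂
step-deterministic open-both    open-both    = (refl , refl) , refl , refl
step-deterministic exc-exc      exc-exc      = (refl , refl) , refl , refl
step-deterministic exc-exc-lost exc-exc-lost = (refl , refl) , refl , refl
step-deterministic def-def      def-def      = (refl , refl) , refl , refl
step-deterministic def-def-lost def-def-lost = (refl , refl) , refl , refl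
step-deterministic close-both   close-both   = (refl , refl) , refl , refl
step-deterministic close-lost-a close-lost-a = (refl , refl) , refl , refl
step-deterministic close-lost-b close-lost-b = (refl , refl) , refl , refl
step-deterministic fixed        fixed        = (refl , refl) , refl , refl

halve-≤ : ∀ {p q k} → p + p ≡ q + q + k → q ≤ p
halve-≤ {p} {q} {k} e = ≮⇒≥ λ p<q → <⇒≢ (<-≤-trans (+-mono-< p<q p<q) (m≤m+n (q + q) k)) e

module Decode {n : ℕ} (W : Word n) where
  open Word W

  #P #V : ℕ → ℕ
  #P = cnt (λ t → P t Bool.≟ true)
  #V = cnt (λ t → V t Bool.≟ true)

  rank-balance : ∀ t → t ≤ n → #P t + #P t ≡ #V t + #V t + (a t + b t)
  rank-balance zero    _   = sym (cong₂ _+_ a-start b-start)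
  rank-balance (suc t) t<n rewrite cnt-true P t | cnt-true V t =
    step-rank (step t t<n) (#P t) (#V t) (rank-balance t (<⇒≤ t<n))

  #V≤#P : ∀ t → t ≤ n → #V t ≤ #P t
  #V≤#P t t≤n = halve-≤ (rank-balance t t≤n)

  V⇒#V<#P : ∀ t → t < n → V t ≡ true → #V t < #P t
  V⇒#V<#P t t<n Vt = ≤∧≢⇒< (#V≤#P t (<⇒≤ t<n)) λ e → <⇒≢ (step-open (step t t<n) Vt)
    (+-cancelˡ-≡ (#V t + #V t) 0 (a t + b t) (trans (+-identityʳ _)
      (trans (cong₂ _+_ e e) (rank-balance t (<⇒≤ t<n)))))

  equal-ranks : ∀ t → t ≤ n → a t + b t ≡ 0 → #P t ≡ #V t
  equal-ranks t t≤n e = double-injective (trans (rank-balance t t≤n)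
    (trans (cong (#V t + #V t +_) e) (+-identityʳ _)))

  #V-suc≤#P : ∀ t → t < n → #V (suc t) ≤ #P t
  #V-suc≤#P t t<n with V t in eq
  ... | true  = V⇒#V<#P t t<n eq
  ... | false = #V≤#P t (<⇒≤ t<n)

  false-rank : ∀ {t} → #P t ≡ #V t → cnt (λ s → P s Bool.≟ false) t ≡ cnt (λ s → V s Bool.≟ false) t
  false-rank {t} e = +-cancelˡ-≡ (#P t) _ _ (trans (cnt-bool P t) (sym (trans (cong (_+ cnt (λ s → V s Bool.≟ false) t) e) (cnt-bool V t))))

  equinumerous : ∀ c → cnt (λ t → P t Bool.≟ c) n ≡ cnt (λ t → V t Bool.≟ c) n
  equinumerous true  = equal-ranks n ≤-refl (cong₂ _+_ a-end b-end)
  equinumerous false = false-rank {n} (equinumerous true)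

  module M  = Matching n P V equinumerous
  module M′ = Matching n V P (λ c → sym (equinumerous c))

  σ τ : ℕ → ℕ
  σ = M.match
  τ = M′.match

  permutation : IsPermutation n σ τ
  permutation = match-permutation n P V equinumerous (λ c → sym (equinumerous c))

  open IsPermutation permutation

  V-σ : ∀ {p} → p < n → V (σ p) ≡ P p
  V-σ p<n = proj₁ (proj₂ (M.match-spec p<n))

  P-τ : ∀ {q} → q < n → P (τ q) ≡ V q
  P-τ q<n = proj₁ (proj₂ (M′.match-spec q<n))

  σ-rank : ∀ {p c} → p < n → P p ≡ c → cnt (λ t → V t Bool.≟ c) (σ p) ≡ cnt (λ t → P t Bool.≟ c) p
  σ-rank p<n refl = proj₂ (proj₂ (M.match-spec p<n))

  -- If `σ p ≤ p`, then `#V (σ p) < #P (σ p) ≤ #P p`, whereas matched elements have equal ranks.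
  P⇒exc : ∀ {p} → p < n → P p ≡ true → p < σ p
  P⇒exc {p} p<n Pp = ≰⇒> λ σp≤p → <⇒≱ (V⇒#V<#P (σ p) (σ< p<n) (trans (V-σ p<n) Pp))
    (≤-trans (cnt-≤-cnt (λ t → P t Bool.≟ true) σp≤p) (≤-reflexive (sym (σ-rank p<n Pp))))

  -- If `p < σ p`, the values up to `p` comprise at most `#P p` marked ones and, by the rank of
  -- `σ p`, at most `#P′ p` unmarked ones: `p` altogether instead of `p + 1`.
  ¬P⇒¬exc : ∀ {p} → p < n → P p ≡ false → σ p ≤ p
  ¬P⇒¬exc {p} p<n Pp = ≮⇒≥ λ p<σp → n≮n p (begin
    suc p                    ≡⟨ sym (cnt-bool V (suc p)) ⟩
    #V (suc p) + #V′ (suc p) ≤⟨ +-mono-≤ (#V-suc≤#P p p<n) (cnt-≤-cnt (λ t → V t Bool.≟ false) p<σp) ⟩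
    #P p + #V′ (σ p)         ≡⟨ cong (#P p +_) (σ-rank p<n Pp) ⟩
    #P p + #P′ p             ≡⟨ cnt-bool P p ⟩
    p                        ∎)
    where
    open ≤-Reasoning
    #P′ = cnt (λ t → P t Bool.≟ false)
    #V′ = cnt (λ t → V t Bool.≟ false)

  -- Marked positions are excedances. For unmarked `p`, matching `p` to itself means that `p` is
  -- unmarked as a value too and `#P p ≡ #V p`, so no excedance is open; only the letter `fixed`
  -- allows this.
  fixed-point : ∀ {p} → p < n → does (σ p ≟ p) ≡ G p
  fixed-point {p} p<n with G p in eq
  ... | true  = dec-true (σ p ≟ p) (M.match-unique p<n (trans Vp (sym Pp))
                  (subst (λ c → cnt (λ t → V t Bool.≟ c) p ≡ cnt (λ t → P t Bool.≟ c) p) (sym Pp)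
                    (sym (false-rank {p} (equal-ranks p (<⇒≤ p<n) a+b≡0)))))
    where
    Pp    = proj₁ (step-G (step p p<n) eq)
    Vp    = proj₁ (proj₂ (step-G (step p p<n) eq))
    a+b≡0 = proj₂ (proj₂ (step-G (step p p<n) eq))
  ... | false = dec-false (σ p ≟ p) λ σp≡p → case P p Bool.≟ true of λ where
        (yes Pp) → <⇒≢ (P⇒exc p<n Pp) (sym σp≡p)
        (no ¬Pp) → not-fixed σp≡p (Bool.¬-not ¬Pp)
    where
    not-fixed : σ p ≡ p → P p ≡ false → ⊥
    not-fixed σp≡p Pp = case trans (sym eq) (step-G⁻¹ (step p p<n) Pp Vp a+b≡0) of λ ()
      where
      Vp : V p ≡ false
      Vp = trans (cong V (sym σp≡p)) (trans (V-σ p<n) Pp)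
      rank-false : cnt (λ t → P t Bool.≟ false) p ≡ cnt (λ t → V t Bool.≟ false) p
      rank-false = trans (sym (σ-rank p<n Pp)) (cong (cnt (λ t → V t Bool.≟ false)) σp≡p)
      rank-true : #P p ≡ #V p
      rank-true = +-cancelʳ-≡ (cnt (λ t → P t Bool.≟ false) p) (#P p) (#V p)
        (trans (cnt-bool P p) (sym (trans (cong (#V p +_) rank-false) (cnt-bool V p))))
      a+b≡0 : a p + b p ≡ 0
      a+b≡0 = sym (+-cancelˡ-≡ (#V p + #V p) 0 (a p + b p) (trans (+-identityʳ _)
        (trans (sym (cong₂ _+_ rank-true rank-true)) (rank-balance p (<⇒≤ p<n)))))

  -- Two of any three positions share a colour, and on a colour the matching increases.
  σ-avoids321 : Avoids321 n σ
  σ-avoids321 {p} {q} {r} p<q q<r r<n σq<σp σr<σq with P p Bool.≟ P q | P q Bool.≟ P r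
  ... | yes same | _        = <⇒≯ σq<σp (M.match-mono p<q (<-trans q<r r<n) same)
  ... | no _     | yes same = <⇒≯ σr<σq (M.match-mono q<r r<n same)
  ... | no p≢q   | no q≢r   = <⇒≯ (<-trans σr<σq σq<σp) (M.match-mono (<-trans p<q q<r) r<n
                                (trans (Bool.¬-not p≢q) (sym (Bool.¬-not (q≢r ∘ sym)))))

  exc-count : cnt (λ p → p <? σ p) n ≡ #V n
  exc-count = trans (cnt-ext (λ p → p <? σ p) (λ t → P t Bool.≟ true) n
    (λ p p<n lt → Bool.¬-not λ Pp → <⇒≱ lt (¬P⇒¬exc p<n Pp)) (λ p p<n → P⇒exc p<n)) (equinumerous true)

  fixed-count : cnt (λ p → σ p ≟ p) n ≡ cnt (λ t → G t Bool.≟ true) n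
  fixed-count = cnt-ext (λ p → σ p ≟ p) (λ t → G t Bool.≟ true) n
    (λ p p<n e → trans (sym (fixed-point p<n)) (dec-true (σ p ≟ p) e))
    (λ p p<n g → case σ p ≟ p of λ where
      (yes e) → e
      (no ¬e) → case trans (sym (dec-false (σ p ≟ p) ¬e)) (trans (fixed-point p<n) g) of λ ())

-- The marks are recovered from the permutation, `P` as its excedances and `V` as their values;
-- `step-deterministic` then replays states and turns from the common start.
module DecodeInjective {n : ℕ} (W W′ : Word n) (same : ∀ {p} → p < n → Decode.σ W p ≡ Decode.σ W′ p) where
  open Word W
  open Word W′ using () renaming (a to a′; b to b′; P to P′; V to V′; X to X′; Y to Y′; step to step′; a-start to a′-start; b-start to b′-start)
  module D  = Decode W
  module D′ = Decode W′

  sameP : ∀ {p} → p < n → P p ≡ P′ p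
  sameP {p} p<n with P p in e | P′ p in e′
  ... | true  | true  = refl
  ... | false | false = refl
  ... | true  | false = contradiction (D′.¬P⇒¬exc p<n e′) (<⇒≱ (subst (p <_) (same p<n) (D.P⇒exc p<n e)))
  ... | false | true  = contradiction (subst (_≤ p) (same p<n) (D.¬P⇒¬exc p<n e)) (<⇒≱ (D′.P⇒exc p<n e′))

  sameV : ∀ {q} → q < n → V q ≡ V′ q
  sameV {q} q<n = begin
    V q             ≡⟨ sym (D.P-τ q<n) ⟩
    P (D.τ q)       ≡⟨ sameP (τ< q<n) ⟩
    P′ (D.τ q)      ≡⟨ sym (D′.V-σ (τ< q<n)) ⟩
    V′ (D′.σ (D.τ q)) ≡⟨ cong V′ (trans (sym (same (τ< q<n))) (στ q<n)) ⟩
    V′ q            ∎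
    where
    open ≡-Reasoning
    open IsPermutation D.permutation

  same-states : ∀ t → t ≤ n → a t ≡ a′ t × b t ≡ b′ t
  same-step : ∀ t → t < n → (a (suc t) ≡ a′ (suc t) × b (suc t) ≡ b′ (suc t)) × X t ≡ X′ t × Y t ≡ Y′ t

  same-states zero    _   = trans a-start (sym a′-start) , trans b-start (sym b′-start)
  same-states (suc t) t<n = proj₁ (same-step t t<n)

  same-step t t<n = step-deterministic (transport (same-states t (<⇒≤ t<n)) (sameP t<n) (sameV t<n) (step t t<n)) (step′ t t<n)
    where
    transport : ∀ {α β α₁ β₁ π ν x y g α′ β′ π′ ν′} → α ≡ α′ × β ≡ β′ → π ≡ π′ → ν ≡ ν′ →
      Step α β α₁ β₁ π ν x y g → Step α′ β′ α₁ β₁ π′ ν′ x y g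
    transport (refl , refl) refl refl s = s

-- Longest increasing subsequences

fromDoes : ∀ {A : Set} (a? : Dec A) → does a? ≡ true → A
fromDoes (yes a) _ = a

# : (ℕ → Bool) → ℕ → ℕ
# S = cnt (λ p → S p Bool.≟ true)

IncreasingOn : (ℕ → ℕ) → ℕ → (ℕ → Bool) → Set
IncreasingOn σ t S = ∀ {p q} → p < q → q < t → S p ≡ true → S q ≡ true → σ p < σ q

-- Sequences are given as sets of positions. `Longest τ t k` speaks of the entries with value below
-- `t`, since an increasing sequence of `τ` is one of `σ` listed by values.
record Longest (σ : ℕ → ℕ) (t k : ℕ) : Set where
  field
    upper   : ∀ S → IncreasingOn σ t S → # S t ≤ k
    witness : ∃ λ S → IncreasingOn σ t S × k ≤ # S t

longest-zero : ∀ {σ} → Longest σ 0 0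
longest-zero = record { upper = λ _ _ → z≤n ; witness = (λ _ → false) , (λ _ ()) , z≤n }

restrict : ∀ {σ t S} → IncreasingOn σ (suc t) S → IncreasingOn σ t S
restrict inc p<q q<t = inc p<q (m<n⇒m<1+n q<t)

longest-maximum : ∀ {σ t k} → (∀ {p} → p < t → σ p < σ t) → Longest σ t k → Longest σ (suc t) (suc k)
longest-maximum {σ} {t} {k} max L = record
  { upper   = λ S inc → ≤-trans (cnt-suc-≤ (λ p → S p Bool.≟ true) t) (s≤s (upper S (restrict inc)))
  ; witness = S′ , inc′ , subst (suc k ≤_) (sym (cnt-yes (λ p → S′ p Bool.≟ true) {t} (dec-true (S′? t) (inj₁ refl))))
      (s≤s (≤-trans k≤ (cnt-mono (λ p → S p Bool.≟ true) (λ p → S′ p Bool.≟ true) t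
        (λ p _ Sp → dec-true (S′? p) (inj₂ Sp))))) }
  where
  open Longest L
  S = proj₁ witness
  inc = proj₁ (proj₂ witness)
  k≤ = proj₂ (proj₂ witness)
  S′? : ∀ p → Dec (p ≡ t ⊎ S p ≡ true)
  S′? p = (p ≟ t) ⊎-dec (S p Bool.≟ true)
  S′ : ℕ → Bool
  S′ p = does (S′? p)
  inc′ : IncreasingOn σ (suc t) S′
  inc′ {p} {q} p<q q≤t S′p S′q with fromDoes (S′? p) S′p | fromDoes (S′? q) S′q
  ... | inj₁ refl | _         = contradiction p<q (≤⇒≯ (≤-pred q≤t))
  ... | inj₂ Sp   | inj₁ refl = max p<q
  ... | inj₂ Sp   | inj₂ Sq with m≤n⇒m<n∨m≡n (≤-pred q≤t)
  ...   | inj₁ q<t  = inc p<q q<t Sp Sq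
  ...   | inj₂ refl = max p<q

-- A deficient last entry: sequences using it are traded, through the inverse, for sequences
-- among the values below t, which may in addition use the g later entries with value below t.
module Deficient {n : ℕ} {σ τ : ℕ → ℕ} (π : IsPermutation n σ τ)
  (def-mono : ∀ {p q} → p < q → q < n → σ p < p → σ q < q → σ p < σ q)
  {t : ℕ} (t<n : t < n) (σt<t : σ t < t) {k m g k′ : ℕ}
  (L : Longest σ t k) (L⁻¹ : Longest τ t m) (g≡ : cnt (λ q → t <? τ q) t ≡ g) where
  open IsPermutation π

  below : ∀ {p} → p < t → p < n
  below p<t = <-trans p<t t<n

  -- For `S` containing `t`, let `R` consist of the values used by `S` and of the `g` values below
  -- `t` that occur after `t`. The later entries are deficient, like the one at `t`, so they
  -- increase and exceed `σ t`, the largest value of `S`. Hence `R` is increasing for `τ`, and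
  -- `# S (suc t) + g ≤ m`.
  deficient-upper : k ≤ k′ → m ≤ k′ + g → ∀ S → IncreasingOn σ (suc t) S → # S (suc t) ≤ k′
  deficient-upper k≤ m≤ S inc with S t Bool.≟ true
  ... | no ¬St = ≤-trans (Longest.upper L S (restrict inc)) k≤
  ... | yes St = +-cancelʳ-≤ g _ k′ (begin
      suc (# S t) + g               ≡⟨ cong (_+ g) (sym (cnt-yes (λ p → S p Bool.≟ true) St)) ⟩
      # S (suc t) + g               ≤⟨ +-mono-≤ earlier (≤-reflexive (sym g≡)) ⟩
      cnt (λ q → (R q Bool.≟ true) ×-dec ¬? (t <? τ q)) t + cnt (λ q → t <? τ q) t
                                    ≤⟨ +-monoʳ-≤ _ later ⟩
      cnt (λ q → (R q Bool.≟ true) ×-dec ¬? (t <? τ q)) t + cnt (λ q → (R q Bool.≟ true) ×-dec (t <? τ q)) t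
                                    ≡⟨ +-comm (cnt (λ q → (R q Bool.≟ true) ×-dec ¬? (t <? τ q)) t) _ ⟩
      cnt (λ q → (R q Bool.≟ true) ×-dec (t <? τ q)) t + cnt (λ q → (R q Bool.≟ true) ×-dec ¬? (t <? τ q)) t
                                    ≡⟨ sym (cnt-split (λ q → R q Bool.≟ true) (λ q → t <? τ q) t) ⟩
      # R t                         ≤⟨ Longest.upper L⁻¹ R R-inc ⟩
      m                             ≤⟨ m≤ ⟩
      k′ + g                        ∎)
    where
    open ≤-Reasoning
    R? : ∀ q → Dec (t < τ q ⊎ (τ q ≤ t × S (τ q) ≡ true))
    R? q = (t <? τ q) ⊎-dec ((τ q ≤? t) ×-dec (S (τ q) Bool.≟ true))
    R : ℕ → Bool
    R q = does (R? q)

    later : cnt (λ q → t <? τ q) t ≤ cnt (λ q → (R q Bool.≟ true) ×-dec (t <? τ q)) t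
    later = cnt-mono (λ q → t <? τ q) (λ q → (R q Bool.≟ true) ×-dec (t <? τ q)) t
      (λ q _ t<τq → dec-true (R? q) (inj₁ t<τq) , t<τq)

    earlier : # S (suc t) ≤ cnt (λ q → (R q Bool.≟ true) ×-dec ¬? (t <? τ q)) t
    earlier = cnt-injection (λ p → S p Bool.≟ true) (λ q → (R q Bool.≟ true) ×-dec ¬? (t <? τ q)) (suc t) t σ
      (λ p p≤t Sp → let τσp = τσ (≤-<-trans (≤-pred p≤t) t<n) in
        [ (λ p<t → <-trans (inc p<t ≤-refl Sp St) σt<t) , (λ { refl → σt<t }) ]′ (m≤n⇒m<n∨m≡n (≤-pred p≤t)) ,
        dec-true (R? (σ p)) (inj₂ (subst (_≤ t) (sym τσp) (≤-pred p≤t) , trans (cong S τσp) Sp)) ,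
        λ t<τσp → <⇒≱ t<τσp (subst (_≤ t) (sym τσp) (≤-pred p≤t)))
      (λ p q p≤t q≤t _ _ → σ-injective (≤-<-trans (≤-pred p≤t) t<n) (≤-<-trans (≤-pred q≤t) t<n))

    deficient : ∀ {q} → q < t → t < τ q → σ (τ q) < τ q
    deficient {q} q<t t<τq = subst (_< τ q) (sym (στ (below q<t))) (<-trans q<t t<τq)

    R-inc : IncreasingOn τ t R
    R-inc {q} {r} q<r r<t Rq Rr with fromDoes (R? q) Rq | fromDoes (R? r) Rr
    ... | inj₂ (τq≤t , _) | inj₁ t<τr = ≤-<-trans τq≤t t<τr
    ... | inj₂ (τq≤t , Sq) | inj₂ (τr≤t , Sr) = ≰⇒> λ τr≤τq → <⇒≱ q<r
          ([ (λ τr<τq → <⇒≤ (subst₂ _<_ (στ (below r<t)) (στ (below (<-trans q<r r<t))) (inc τr<τq (s≤s τq≤t) Sr Sq)))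
           , (λ e → ≤-reflexive (trans (sym (στ (below r<t))) (trans (cong σ e) (στ (below (<-trans q<r r<t)))))) ]′
           (m≤n⇒m<n∨m≡n τr≤τq))
    ... | inj₁ t<τq | inj₁ t<τr = ≰⇒> λ τr≤τq → <⇒≱ q<r
          ([ (λ τr<τq → <⇒≤ (subst₂ _<_ (στ (below r<t)) (στ (below (<-trans q<r r<t)))
                (def-mono τr<τq (τ< (below (<-trans q<r r<t))) (deficient r<t t<τr) (deficient (<-trans q<r r<t) t<τq))))
           , (λ e → ≤-reflexive (trans (sym (στ (below r<t))) (trans (cong σ e) (στ (below (<-trans q<r r<t)))))) ]′
           (m≤n⇒m<n∨m≡n τr≤τq))
    ... | inj₁ t<τq | inj₂ (τr≤t , Sr) = contradiction (<-≤-trans q<r r≤σt) (<⇒≯ σt<q)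
      where
      q<t = <-trans q<r r<t
      σt<q : σ t < q
      σt<q = subst (σ t <_) (στ (below q<t)) (def-mono t<τq (τ< (below q<t)) σt<t (deficient q<t t<τq))
      r≤σt : r ≤ σ t
      r≤σt = [ (λ τr<t → <⇒≤ (subst (_< σ t) (στ (below r<t)) (inc τr<t ≤-refl Sr St)))
             , (λ e → ≤-reflexive (trans (sym (στ (below r<t))) (cong σ e))) ]′ (m≤n⇒m<n∨m≡n τr≤t)

  -- From a longest sequence of values below `t` the entries at positions beyond `t` are removed;
  -- there are at most `g` of them.
  deficient-witness : k′ + g ≤ m → ∃ λ S → IncreasingOn σ (suc t) S × k′ ≤ # S (suc t)
  deficient-witness le = S , S-inc , +-cancelʳ-≤ g k′ _ (begin
      k′ + g              ≤⟨ le ⟩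
      m                   ≤⟨ proj₂ (proj₂ (Longest.witness L⁻¹)) ⟩
      # R t               ≡⟨ cnt-split (λ q → R q Bool.≟ true) (λ q → t <? τ q) t ⟩
      cnt (λ q → (R q Bool.≟ true) ×-dec (t <? τ q)) t + cnt (λ q → (R q Bool.≟ true) ×-dec ¬? (t <? τ q)) t
                          ≤⟨ +-mono-≤ (≤-trans (cnt-mono (λ q → (R q Bool.≟ true) ×-dec (t <? τ q)) (λ q → t <? τ q) t (λ _ _ → proj₂)) (≤-reflexive g≡)) earlier ⟩
      g + # S (suc t)     ≡⟨ +-comm g _ ⟩
      # S (suc t) + g     ∎)
    where
    open ≤-Reasoning
    R = proj₁ (Longest.witness L⁻¹)
    R-inc = proj₁ (proj₂ (Longest.witness L⁻¹))
    S? : ∀ p → Dec (σ p < t × R (σ p) ≡ true)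
    S? p = (σ p <? t) ×-dec (R (σ p) Bool.≟ true)
    S : ℕ → Bool
    S p = does (S? p)
    S-inc : IncreasingOn σ (suc t) S
    S-inc {p} {q} p<q q≤t Sp Sq = ≰⇒> λ σq≤σp →
      [ (λ σq<σp → <⇒≯ p<q (subst₂ _<_ (τσ q<n) (τσ p<n) (R-inc σq<σp (proj₁ (fromDoes (S? p) Sp)) (proj₂ (fromDoes (S? q) Sq)) (proj₂ (fromDoes (S? p) Sp)))))
      , (λ e → <⇒≢ p<q (sym (σ-injective q<n p<n e))) ]′ (m≤n⇒m<n∨m≡n σq≤σp)
      where
      q<n = ≤-<-trans (≤-pred q≤t) t<n
      p<n = <-trans p<q q<n
    earlier : cnt (λ q → (R q Bool.≟ true) ×-dec ¬? (t <? τ q)) t ≤ # S (suc t)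
    earlier = cnt-injection (λ q → (R q Bool.≟ true) ×-dec ¬? (t <? τ q)) (λ p → S p Bool.≟ true) t (suc t) τ
      (λ q q<t (Rq , t≮τq) → s≤s (≮⇒≥ t≮τq) , dec-true (S? (τ q))
        (subst (_< t) (sym (στ (below q<t))) q<t , trans (cong R (στ (below q<t))) Rq))
      (λ q r q<t r<t _ _ → IsPermutation.σ-injective (inverse π) (below q<t) (below r<t))

  longest-kept : k ≡ k′ → m ≤ k′ + g → Longest σ (suc t) k′
  longest-kept refl m≤ = record
    { upper   = deficient-upper ≤-refl m≤
    ; witness = S , inc′ , ≤-trans k≤ (≤-trans
        (cnt-mono (λ p → S₀ p Bool.≟ true) (λ p → S p Bool.≟ true) t (λ p p<t S₀p → dec-true (S? p) (S₀p , p<t)))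
        (cnt-≤-cnt (λ p → S p Bool.≟ true) (n≤1+n t))) }
    where
    S₀ = proj₁ (Longest.witness L)
    inc = proj₁ (proj₂ (Longest.witness L))
    k≤ = proj₂ (proj₂ (Longest.witness L))
    -- `S₀` is known to be increasing only below `t`, hence the truncation.
    S? : ∀ p → Dec (S₀ p ≡ true × p < t)
    S? p = (S₀ p Bool.≟ true) ×-dec (p <? t)
    S : ℕ → Bool
    S p = does (S? p)
    inc′ : IncreasingOn σ (suc t) S
    inc′ {p} {q} p<q _ Sp Sq = inc p<q (proj₂ (fromDoes (S? q) Sq)) (proj₁ (fromDoes (S? p) Sp)) (proj₁ (fromDoes (S? q) Sq))

  longest-extended : k′ ≡ suc k → m ≡ k′ + g → Longest σ (suc t) k′
  longest-extended refl m≡ = record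
    { upper   = deficient-upper (n≤1+n k) (≤-reflexive m≡)
    ; witness = deficient-witness (≤-reflexive (sym m≡)) }

-- The values of `B` below `t` split by position. Those at positions below `t` correspond to `A`
-- under `σ`; among those from `t` on, `low` ensures that no value outside `B` occurs.
overhang-count : ∀ {n σ τ} → IsPermutation n σ τ → {A B : ℕ → Set} (A? : ∀ p → Dec (A p)) (B? : ∀ q → Dec (B q)) →
  ∀ {t} → t ≤ n → (∀ {p} → p < t → A p → σ p < t × B (σ p)) → (∀ {q} → q < t → B q → τ q < t → A (τ q)) →
  (∀ {q} → q < t → ¬ B q → τ q < t) → cnt B? t ≡ cnt A? t + cnt (λ q → t ≤? τ q) t
overhang-count {n} {σ} {τ} π A? B? {t} t≤n forth back low = begin
  cnt B? t
    ≡⟨ cnt-split B? (λ q → t ≤? τ q) t ⟩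
  cnt (λ q → B? q ×-dec (t ≤? τ q)) t + cnt (λ q → B? q ×-dec ¬? (t ≤? τ q)) t
    ≡⟨ cong₂ _+_ (cnt-ext (λ q → B? q ×-dec (t ≤? τ q)) (λ q → t ≤? τ q) t (λ _ _ → proj₂)
         (λ q q<t t≤τq → decidable-stable (B? q) (λ ¬Bq → <⇒≱ (low q<t ¬Bq) t≤τq) , t≤τq))
       (≤-antisym
         (cnt-injection (λ q → B? q ×-dec ¬? (t ≤? τ q)) A? t t τ
           (λ q q<t (Bq , t≰) → ≰⇒> t≰ , back q<t Bq (≰⇒> t≰))
           (λ q r q<t r<t _ _ → IsPermutation.σ-injective (inverse π) (<-≤-trans q<t t≤n) (<-≤-trans r<t t≤n)))
         (cnt-injection A? (λ q → B? q ×-dec ¬? (t ≤? τ q)) t t σ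
           (λ p p<t Ap → proj₁ (forth p<t Ap) , proj₂ (forth p<t Ap) ,
             λ t≤ → <⇒≱ p<t (subst (t ≤_) (τσ (<-≤-trans p<t t≤n)) t≤))
           (λ p q p<t q<t _ _ → σ-injective (<-≤-trans p<t t≤n) (<-≤-trans q<t t≤n)))) ⟩
  cnt (λ q → t ≤? τ q) t + cnt A? t
    ≡⟨ +-comm (cnt (λ q → t ≤? τ q) t) _ ⟩
  cnt A? t + cnt (λ q → t ≤? τ q) t ∎
  where
  open ≡-Reasoning
  open IsPermutation π

strict-overhang : ∀ {n σ τ} → IsPermutation n σ τ → ∀ {t} → t < n → σ t < t →
  cnt (λ q → t ≤? τ q) t ≡ suc (cnt (λ q → t <? τ q) t)
strict-overhang {n} {σ} {τ} π {t} t<n σt<t = cnt-point (λ q → t ≤? τ q) (λ q → t <? τ q) t (σ t) σt<t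
  (≤-reflexive (sym (τσ t<n))) (λ lt → <⇒≢ lt (sym (τσ t<n)))
  (λ q q<t q≢ t≤τq → ≤∧≢⇒< t≤τq λ e → q≢ (trans (sym (στ (<-trans q<t t<n))) (cong σ (sym e))))
  (λ _ _ → <⇒≤)
  where open IsPermutation π

-- Length invariants along the word

suc-suc : ∀ k p → suc (suc (k + p)) ≡ suc k + suc p
suc-suc k p = sym (cong suc (+-suc k p))

suc₁₂ : ∀ m b q → suc m + suc b + q ≡ suc (suc (m + b + q))
suc₁₂ = solve-∀

suc₁₃ : ∀ m b q → suc m + b + suc q ≡ suc (suc (m + b + q))
suc₁₃ = solve-∀

suc₂₃ : ∀ m b q → m + suc b + suc q ≡ suc (suc (m + b + q))
suc₂₃ = solve-∀

suc₂ : ∀ m b q → m + suc b + q ≡ suc (m + b + q)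
suc₂ = solve-∀

suc₃ : ∀ m b q → m + b + suc q ≡ suc (m + b + q)
suc₃ = solve-∀

-- Additive form of `d + b = e + h`, with `k` for `e`, `m` for `d` and `p - q` for `h`: `e` and `d`
-- grow exactly where `X` and `Y` are false. `step-swap-length` treats `e + a = d + h`.
step-length : ∀ {a b a′ b′ P V X Y G} → Step a b a′ b′ P V X Y G → ∀ k m p q →
  m + b + q ≡ k + p → (⟦ not Y ⟧ + m) + b′ + (⟦ V ⟧ + q) ≡ (⟦ not X ⟧ + k) + (⟦ P ⟧ + p)
step-length {b = b} open-both    k m p q e = trans (suc₁₂ m b q) (trans (cong (λ z → suc (suc z)) e) (suc-suc k p))
step-length {b = b} exc-exc      k m p q e = trans (suc₂₃ m b q) (trans (cong (λ z → suc (suc z)) e) (suc-suc k p))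
step-length {b = b} exc-exc-lost k m p q e = trans (suc₁₃ m b q) (trans (cong (λ z → suc (suc z)) e) (suc-suc k p))
step-length {b = suc b} def-def  k m p q e = trans (sym (suc₂ m b q)) e
step-length def-def-lost         k m p q e = cong suc e
step-length {b = suc b} close-both k m p q e = trans (suc₃ m b q) (trans (sym (suc₂ m b q)) e)
step-length {b = suc (suc b)} close-lost-a k m p q e =
  trans (suc₁₃ m b q) (trans (cong suc (sym (suc₂ m b q))) (trans (sym (suc₂ m (suc b) q)) e))
step-length close-lost-b         k m p q e = trans (suc₃ m 0 q) (cong suc e)
step-length fixed                k m p q e = cong suc e

step-swap-length : ∀ {a b a′ b′ P V X Y G} → Step a b a′ b′ P V X Y G → ∀ k m p q →
  k + a + q ≡ m + p → (⟦ not X ⟧ + k) + a′ + (⟦ V ⟧ + q) ≡ (⟦ not Y ⟧ + m) + (⟦ P ⟧ + p)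
step-swap-length {a} open-both   k m p q e = trans (suc₁₂ k a q) (trans (cong (λ z → suc (suc z)) e) (suc-suc m p))
step-swap-length {suc a} exc-exc k m p q e =
  trans (suc₁₃ k a q) (trans (cong suc (trans (sym (suc₂ k a q)) e)) (sym (+-suc m p)))
step-swap-length exc-exc-lost    k m p q e = trans (suc₁₃ k 0 q) (trans (cong (λ z → suc (suc z)) e) (suc-suc m p))
step-swap-length {a} def-def     k m p q e = trans (suc₂ k a q) (cong suc e)
step-swap-length def-def-lost    k m p q e = cong suc e
step-swap-length {suc a} close-both k m p q e = trans (suc₃ k a q) (trans (sym (suc₂ k a q)) e)
step-swap-length close-lost-a    k m p q e = trans (suc₃ k 0 q) (cong suc e)
step-swap-length {suc (suc a)} close-lost-b k m p q e =
  trans (suc₁₃ k a q) (trans (cong suc (sym (suc₂ k a q))) (trans (sym (suc₂ k (suc a) q)) e))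
step-swap-length fixed           k m p q e = cong suc e

-- The first alternative is a new maximum, where `e` must grow; the second is a deficient position,
-- where `b` decides. `step-column` does the same for `τ`, with a new maximum whenever `V` is false.
step-row : ∀ {a b a′ b′ P V X Y G} → Step a b a′ b′ P V X Y G →
  (X ≡ false × (P ≡ true ⊎ G ≡ true)) ⊎ (P ≡ false × G ≡ false × ((X ≡ true × 0 < b) ⊎ (X ≡ false × b ≡ 0)))
step-row open-both    = inj₁ (refl , inj₁ refl)
step-row exc-exc      = inj₁ (refl , inj₁ refl)
step-row exc-exc-lost = inj₁ (refl , inj₁ refl)
step-row def-def      = inj₂ (refl , refl , inj₁ (refl , s≤s z≤n))
step-row def-def-lost = inj₂ (refl , refl , inj₂ (refl , refl))
step-row close-both   = inj₂ (refl , refl , inj₁ (refl , s≤s z≤n))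
step-row close-lost-a = inj₂ (refl , refl , inj₁ (refl , s≤s z≤n))
step-row close-lost-b = inj₂ (refl , refl , inj₂ (refl , refl))
step-row fixed        = inj₁ (refl , inj₂ refl)

step-column : ∀ {a b a′ b′ P V X Y G} → Step a b a′ b′ P V X Y G →
  (Y ≡ false × V ≡ false) ⊎ (V ≡ true × ((Y ≡ true × 0 < a) ⊎ (Y ≡ false × a ≡ 0)))
step-column open-both    = inj₁ (refl , refl)
step-column exc-exc      = inj₂ (refl , inj₁ (refl , s≤s z≤n))
step-column exc-exc-lost = inj₂ (refl , inj₂ (refl , refl))
step-column def-def      = inj₁ (refl , refl)
step-column def-def-lost = inj₁ (refl , refl)
step-column close-both   = inj₂ (refl , inj₁ (refl , s≤s z≤n))
step-column close-lost-a = inj₂ (refl , inj₂ (refl , refl))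
step-column close-lost-b = inj₂ (refl , inj₁ (refl , s≤s z≤n))
step-column fixed        = inj₁ (refl , refl)

module Length {n : ℕ} (W : Word n) where
  open Word W
  open Decode W
  open IsPermutation permutation

  #¬ : (ℕ → Bool) → ℕ → ℕ
  #¬ A = cnt (λ s → A s Bool.≟ false)

  #¬-suc : ∀ A t → #¬ A (suc t) ≡ ⟦ not (A t) ⟧ + #¬ A t
  #¬-suc A t with A t
  ... | true  = refl
  ... | false = refl

  length-balance : ∀ t → t ≤ n → #¬ Y t + b t + #V t ≡ #¬ X t + #P t
  length-balance zero    _   = trans (+-identityʳ _) b-start
  length-balance (suc t) t<n rewrite #¬-suc X t | #¬-suc Y t | cnt-true V t | cnt-true P t =
    step-length (step t t<n) (#¬ X t) (#¬ Y t) (#P t) (#V t) (length-balance t (<⇒≤ t<n))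

  length-balance′ : ∀ t → t ≤ n → #¬ X t + a t + #V t ≡ #¬ Y t + #P t
  length-balance′ zero    _   = trans (+-identityʳ _) a-start
  length-balance′ (suc t) t<n rewrite #¬-suc X t | #¬-suc Y t | cnt-true V t | cnt-true P t =
    step-swap-length (step t t<n) (#¬ X t) (#¬ Y t) (#P t) (#V t) (length-balance′ t (<⇒≤ t<n))

  V-exc : ∀ {q} → q < n → V q ≡ true → τ q < q
  V-exc q<n Vq = subst (τ _ <_) (στ q<n) (P⇒exc (τ< q<n) (trans (P-τ q<n) Vq))

  V-¬exc : ∀ {q} → q < n → V q ≡ false → q ≤ τ q
  V-¬exc q<n Vq = subst (_≤ τ _) (στ q<n) (¬P⇒¬exc (τ< q<n) (trans (P-τ q<n) Vq))

  -- This expresses `h` by the values below `t` that stand at positions from `t` on.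
  -- `overhang-count` compares the unmarked positions and values, and both colours together number
  -- `t` on either side.
  #P≡#V+τ : ∀ {t} → t ≤ n → #P t ≡ #V t + cnt (λ q → t ≤? τ q) t
  #P≡#V+τ {t} t≤n = +-cancelʳ-≡ (#¬ P t) (#P t) _ (begin
    #P t + #¬ P t                            ≡⟨ trans (cnt-bool P t) (sym (cnt-bool V t)) ⟩
    #V t + #¬ V t                            ≡⟨ cong (#V t +_) (overhang-count permutation (λ s → P s Bool.≟ false) (λ s → V s Bool.≟ false) t≤n
                                                  (λ p<t Pp → ≤-<-trans (¬P⇒¬exc (<-≤-trans p<t t≤n) Pp) p<t , trans (V-σ (<-≤-trans p<t t≤n)) Pp)
                                                  (λ q<t Vq _ → trans (P-τ (<-≤-trans q<t t≤n)) Vq)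
                                                  (λ q<t ¬Vq → <-trans (V-exc (<-≤-trans q<t t≤n) (Bool.¬-not ¬Vq)) q<t)) ⟩
    #V t + (#¬ P t + H)                      ≡⟨ cong (#V t +_) (+-comm (#¬ P t) H) ⟩
    #V t + (H + #¬ P t)                      ≡⟨ sym (+-assoc (#V t) H (#¬ P t)) ⟩
    #V t + H + #¬ P t                        ∎)
    where
    open ≡-Reasoning
    H = cnt (λ q → t ≤? τ q) t

  #P≡#V+σ : ∀ {t} → t ≤ n → #P t ≡ #V t + cnt (λ p → t ≤? σ p) t
  #P≡#V+σ {t} t≤n = overhang-count (inverse permutation) (λ s → V s Bool.≟ true) (λ s → P s Bool.≟ true) t≤n
    (λ q<t Vq → <-trans (V-exc (<-≤-trans q<t t≤n) Vq) q<t , trans (P-τ (<-≤-trans q<t t≤n)) Vq)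
    (λ p<t Pp _ → trans (V-σ (<-≤-trans p<t t≤n)) Pp)
    (λ p<t ¬Pp → ≤-<-trans (¬P⇒¬exc (<-≤-trans p<t t≤n) (Bool.¬-not ¬Pp)) p<t)

  σ-def-mono : ∀ {p q} → p < q → q < n → σ p < p → σ q < q → σ p < σ q
  σ-def-mono p<q q<n σp<p σq<q = M.match-mono p<q q<n (trans
    (Bool.¬-not λ Pp → <⇒≯ σp<p (P⇒exc (<-trans p<q q<n) Pp)) (sym (Bool.¬-not λ Pq → <⇒≯ σq<q (P⇒exc q<n Pq))))

  τ-def-mono : ∀ {p q} → p < q → q < n → τ p < p → τ q < q → τ p < τ q
  τ-def-mono p<q q<n τp<p τq<q = M′.match-mono p<q q<n (trans
    (Bool.¬-not λ Vp → <⇒≱ τp<p (V-¬exc (<-trans p<q q<n) Vp)) (sym (Bool.¬-not λ Vq → <⇒≱ τq<q (V-¬exc q<n Vq))))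

  -- For marked `t`, earlier marked entries are smaller by the matching, and unmarked ones satisfy
  -- `σ p ≤ p < t < σ t`. At a fixed point no excedance is open, so earlier excedances have values
  -- below `t`.
  row-maximum : ∀ {t} → t < n → P t ≡ true ⊎ G t ≡ true → ∀ {p} → p < t → σ p < σ t
  row-maximum {t} t<n (inj₁ Pt) {p} p<t with P p Bool.≟ true
  ... | yes Pp = M.match-mono p<t t<n (trans Pp (sym Pt))
  ... | no ¬Pp = ≤-<-trans (¬P⇒¬exc (<-trans p<t t<n) (Bool.¬-not ¬Pp)) (<-trans p<t (P⇒exc t<n Pt))
  row-maximum {t} t<n (inj₂ Gt) {p} p<t = subst (σ p <_) (sym (fromDoes (σ t ≟ t) (trans (fixed-point t<n) Gt))) σp<t
    where
    p<n = <-trans p<t t<n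
    σp<t : σ p < t
    σp<t with P p Bool.≟ true
    ... | yes Pp = cnt-<-cancel (λ s → V s Bool.≟ true) (begin-strict
          #V (σ p) ≡⟨ σ-rank p<n Pp ⟩
          #P p     <⟨ cnt-<-cnt (λ s → P s Bool.≟ true) p<t Pp ⟩
          #P t     ≡⟨ equal-ranks t (<⇒≤ t<n) (proj₂ (proj₂ (step-G (step t t<n) Gt))) ⟩
          #V t     ∎)
          where open ≤-Reasoning
    ... | no ¬Pp = ≤-<-trans (¬P⇒¬exc p<n (Bool.¬-not ¬Pp)) p<t

  column-maximum : ∀ {t} → t < n → V t ≡ false → ∀ {q} → q < t → τ q < τ t
  column-maximum {t} t<n Vt {q} q<t with V q Bool.≟ true
  ... | yes Vq = <-≤-trans (<-trans (V-exc (<-trans q<t t<n) Vq) q<t) (V-¬exc t<n Vt)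
  ... | no ¬Vq = M′.match-mono q<t t<n (trans (Bool.¬-not ¬Vq) (sym Vt))

  cancel-overhang : ∀ {m b q k p g} → m + b + q ≡ k + p → p ≡ q + suc g → m + b ≡ k + suc g
  cancel-overhang {m} {b} {q} {k} {g = g} e refl = +-cancelʳ-≡ q (m + b) (k + suc g)
    (trans e (trans (cong (k +_) (+-comm q (suc g))) (sym (+-assoc k (suc g) q))))

  positive-bound : ∀ {m b k g} → 0 < b → m + b ≡ k + suc g → m ≤ k + g
  positive-bound {m} {suc b} {k} {g} _ e = ≤-trans (m≤m+n m b)
    (≤-reflexive (suc-injective (trans (sym (+-suc m b)) (trans e (+-suc k g)))))

  zero-bound : ∀ {m b k g} → b ≡ 0 → m + b ≡ k + suc g → m ≡ suc k + g
  zero-bound {m} {k = k} {g} refl e = trans (sym (+-identityʳ m)) (trans e (+-suc k g))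

  -- Both lengths advance together because each consults the other. At a deficient position
  -- `h = g + 1`, and `gap` reads `d + b = e + g + 1`: if `b` is positive, `d ≤ e + g` and `e`
  -- stays; if `b` is zero, `d = (e + 1) + g` and `e` grows. Columns exchange `e` with `d` and `b`
  -- with `a`.
  longest : ∀ t → t ≤ n → Longest σ t (#¬ X t) × Longest τ t (#¬ Y t)
  longest zero    _   = longest-zero , longest-zero
  longest (suc t) t<n = row (step-row (step t t<n)) , column (step-column (step t t<n))
    where
    t≤n = <⇒≤ t<n
    Lσ = proj₁ (longest t t≤n)
    Lτ = proj₂ (longest t t≤n)

    stays : ∀ A → A t ≡ true → #¬ A t ≡ #¬ A (suc t)
    stays A At = sym (trans (#¬-suc A t) (cong (λ z → ⟦ not z ⟧ + #¬ A t) At))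
    grows : ∀ A → A t ≡ false → #¬ A (suc t) ≡ suc (#¬ A t)
    grows A At = trans (#¬-suc A t) (cong (λ z → ⟦ not z ⟧ + #¬ A t) At)

    row : _ → Longest σ (suc t) (#¬ X (suc t))
    row (inj₁ (Xt , max)) = subst (Longest σ (suc t)) (sym (grows X Xt)) (longest-maximum (row-maximum t<n max) Lσ)
    row (inj₂ (Pt , Gt , rest)) = by rest
      where
      σt<t : σ t < t
      σt<t = ≤∧≢⇒< (¬P⇒¬exc t<n Pt) λ e → case trans (sym (dec-true (σ t ≟ t) e)) (trans (fixed-point t<n) Gt) of λ ()
      module E = Deficient permutation σ-def-mono t<n σt<t Lσ Lτ refl
      g : ℕ
      g = cnt (λ q → t <? τ q) t
      gap : #¬ Y t + b t ≡ #¬ X t + suc g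
      gap = cancel-overhang {#¬ Y t} {b t} (length-balance t t≤n) (trans (#P≡#V+τ t≤n)
              (cong (#V t +_) (strict-overhang permutation t<n σt<t)))
      by : _ → Longest σ (suc t) (#¬ X (suc t))
      by (inj₁ (Xt , b>0)) = E.longest-kept (stays X Xt)
        (subst (λ z → #¬ Y t ≤ z + g) (stays X Xt) (positive-bound b>0 gap))
      by (inj₂ (Xt , b≡0)) = E.longest-extended (grows X Xt)
        (subst (λ z → #¬ Y t ≡ z + g) (sym (grows X Xt)) (zero-bound b≡0 gap))

    column : _ → Longest τ (suc t) (#¬ Y (suc t))
    column (inj₁ (Yt , Vt)) = subst (Longest τ (suc t)) (sym (grows Y Yt)) (longest-maximum (column-maximum t<n Vt) Lτ)
    column (inj₂ (Vt , rest)) = by rest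
      where
      τt<t : τ t < t
      τt<t = V-exc t<n Vt
      module E = Deficient (inverse permutation) τ-def-mono t<n τt<t Lτ Lσ refl
      g : ℕ
      g = cnt (λ q → t <? σ q) t
      gap : #¬ X t + a t ≡ #¬ Y t + suc g
      gap = cancel-overhang {#¬ X t} {a t} (length-balance′ t t≤n) (trans (#P≡#V+σ t≤n)
              (cong (#V t +_) (strict-overhang (inverse permutation) t<n τt<t)))
      by : _ → Longest τ (suc t) (#¬ Y (suc t))
      by (inj₁ (Yt , a>0)) = E.longest-kept (stays Y Yt)
        (subst (λ z → #¬ X t ≤ z + g) (stays Y Yt) (positive-bound a>0 gap))
      by (inj₂ (Yt , a≡0)) = E.longest-extended (grows Y Yt)
        (subst (λ z → #¬ X t ≡ z + g) (sym (grows Y Yt)) (zero-bound a≡0 gap))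

-- The Simion–Schmidt injection

module _ (n : ℕ) (f : ℕ → ℕ) where

  preimage : ℕ → ℕ
  preimage q with anyUpTo? (λ p → f p ≟ q) n
  ... | yes (p , _) = p
  ... | no _        = 0

  injection⇒permutation : (∀ {p} → p < n → f p < n) → (∀ {p q} → p < n → q < n → f p ≡ f q → p ≡ q) →
    IsPermutation n f preimage
  injection⇒permutation f< f-inj = record
    { σ< = f<
    ; τ< = λ q<n → proj₁ (spec q<n)
    ; τσ = λ p<n → f-inj (proj₁ (spec (f< p<n))) p<n (proj₂ (spec (f< p<n)))
    ; στ = λ q<n → proj₂ (spec q<n)
    }
    where
    spec : ∀ {q} → q < n → preimage q < n × f (preimage q) ≡ q
    spec {q} q<n with anyUpTo? (λ p → f p ≟ q) n
    ... | yes (p , p<n , e) = p<n , e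
    ... | no none = contradiction crowded (<⇒≱ (≤-reflexive (sym all≡)))
      where
      all? : ∀ p → Dec (p ≡ p)
      all? p = p ≟ p
      rest : ℕ
      rest = cnt (λ r → ¬? (r ≟ q)) n
      all≡ : cnt all? n ≡ suc rest
      all≡ = cnt-point all? (λ r → ¬? (r ≟ q)) n q q<n refl (λ ¬e → ¬e refl) (λ _ _ p≢ _ → p≢) (λ _ _ _ → refl)
      crowded : cnt all? n ≤ rest
      crowded = cnt-injection all? (λ r → ¬? (r ≟ q)) n n f
        (λ p p<n _ → f< p<n , λ e → none (p , p<n , e)) (λ p r p<n r<n _ _ → f-inj p<n r<n)

prefixMin : (ℕ → ℕ) → ℕ → ℕ
prefixMin f zero    = f 0
prefixMin f (suc p) = prefixMin f p ⊓ f (suc p)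

prefixMin-antitone : ∀ f {p q} → p ≤ q → prefixMin f q ≤ prefixMin f p
prefixMin-antitone f {p} {q} p≤q with m≤n⇒m<n∨m≡n p≤q
... | inj₂ refl = ≤-refl
prefixMin-antitone f {p} {suc q} _ | inj₁ p<1+q = ≤-trans (m⊓n≤m _ _) (prefixMin-antitone f (≤-pred p<1+q))

prefixMin≤ : ∀ f p → prefixMin f p ≤ f p
prefixMin≤ f zero    = ≤-refl
prefixMin≤ f (suc p) = m⊓n≤n (prefixMin f p) _

prefixMin-attained : ∀ f p → ∃ λ p₀ → p₀ ≤ p × f p₀ ≡ prefixMin f p
prefixMin-attained f zero    = 0 , z≤n , refl
prefixMin-attained f (suc p) with ⊓-sel (prefixMin f p) (f (suc p))
... | inj₁ e = let p₀ , p₀≤p , e₀ = prefixMin-attained f p in p₀ , m≤n⇒m≤1+n p₀≤p , trans e₀ (sym e)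
... | inj₂ e = suc p , ≤-refl , sym e

prefixMin-cong : ∀ {n f g} → (∀ {p} → p < n → f p ≡ g p) → ∀ {p} → p < n → prefixMin f p ≡ prefixMin g p
prefixMin-cong f≡g {zero}  p<n = f≡g p<n
prefixMin-cong f≡g {suc p} p<n = cong₂ _⊓_ (prefixMin-cong f≡g (<-trans (n<1+n p) p<n)) (f≡g p<n)

firstUnused : (ℕ → Bool) → ℕ → ℕ → ℕ
firstUnused U zero       q = q
firstUnused U (suc fuel) q with U q
... | true  = firstUnused U fuel (suc q)
... | false = q

firstUnused-spec : ∀ U fuel {q r} → U r ≡ false → q ≤ r → r < q + fuel →
  U (firstUnused U fuel q) ≡ false × q ≤ firstUnused U fuel q × firstUnused U fuel q ≤ r
firstUnused-spec U zero       {q} {r} Ur q≤r r< = contradiction (subst (r <_) (+-identityʳ q) r<) (≤⇒≯ q≤r)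
firstUnused-spec U (suc fuel) {q} {r} Ur q≤r r< with U q in eq
... | false = eq , ≤-refl , q≤r
... | true  = let unused , above , below = firstUnused-spec U fuel Ur q<r (subst (r <_) (+-suc q fuel) r<)
              in unused , ≤-trans (n≤1+n q) above , below
  where
  q<r : q < r
  q<r = ≤∧≢⇒< q≤r λ { refl → case trans (sym eq) Ur of λ () }

-- The 132-avoider with the same left-to-right minima: every other entry is the least one
-- that is still available above the current minimum.
module Greedy (n : ℕ) (ρ : ℕ → ℕ) where

  low : ℕ → ℕ
  low = prefixMin ρ

  used : ℕ → ℕ → Bool
  pick : ℕ → ℕ

  used? : ∀ p q → Dec (q ≡ pick p ⊎ used p q ≡ true)
  used? p q = (q ≟ pick p) ⊎-dec (used p q Bool.≟ true)

  used zero    q = false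
  used (suc p) q = does (used? p q)

  pick p = firstUnused (used p) n (low p)

  used⇒ : ∀ p {q} → used p q ≡ true → ∃ λ p₀ → p₀ < p × pick p₀ ≡ q
  used⇒ (suc p) {q} u with fromDoes (used? p q) u
  ... | inj₁ e  = p , ≤-refl , sym e
  ... | inj₂ u′ = let p₀ , p₀<p , e = used⇒ p u′ in p₀ , m<n⇒m<1+n p₀<p , e

  ⇒used : ∀ p {p₀} → p₀ < p → used p (pick p₀) ≡ true
  ⇒used (suc p) {p₀} p₀<1+p with m≤n⇒m<n∨m≡n (≤-pred p₀<1+p)
  ... | inj₁ p₀<p = dec-true (used? p (pick p₀)) (inj₂ (⇒used p p₀<p))
  ... | inj₂ refl = dec-true (used? p (pick p₀)) (inj₁ refl)

  used-count : ∀ p → # (used p) n ≤ p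
  used-count zero    = ≤-reflexive (cnt-empty (λ q → used 0 q Bool.≟ true) n λ _ _ ())
  used-count (suc p) = begin
    # (used (suc p)) n              ≡⟨ cnt-split (λ q → used (suc p) q Bool.≟ true) (λ q → q ≟ pick p) n ⟩
    cnt (λ q → (used (suc p) q Bool.≟ true) ×-dec (q ≟ pick p)) n + cnt (λ q → (used (suc p) q Bool.≟ true) ×-dec ¬? (q ≟ pick p)) n
                                    ≤⟨ +-mono-≤
                                         (cnt-injection (λ q → (used (suc p) q Bool.≟ true) ×-dec (q ≟ pick p)) (λ r → r ≟ 0) n 1 (λ _ → 0)
                                           (λ _ _ _ → s≤s z≤n , refl) (λ _ _ _ _ (_ , e) (_ , e′) _ → trans e (sym e′)))
                                         (cnt-mono (λ q → (used (suc p) q Bool.≟ true) ×-dec ¬? (q ≟ pick p)) (λ q → used p q Bool.≟ true) n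
                                           (λ q _ (u , ≢) → [ (λ e → contradiction e ≢) , id ]′ (fromDoes (used? p q) u))) ⟩
    cnt (λ r → r ≟ 0) 1 + # (used p) n ≤⟨ s≤s (used-count p) ⟩
    suc p                           ∎
    where open ≤-Reasoning

  module _ (ρ< : ∀ {p} → p < n → ρ p < n) (ρ-injective : ∀ {p q} → p < n → q < n → ρ p ≡ ρ q → p ≡ q) where

    -- The `p + 1` values `ρ 0`, ..., `ρ p` are all at least `low p`, and at most `p` values are
    -- used.
    available : ∀ {p} → p < n → ∃ λ r → r < n × low p ≤ r × used p r ≡ false
    available {p} p<n with anyUpTo? (λ r → (low p ≤? r) ×-dec (used p r Bool.≟ false)) n
    ... | yes found = found
    ... | no none = contradiction (≤-trans crowded (used-count p)) (<⇒≱ (≤-reflexive (sym all≡)))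
      where
      all? : ∀ q → Dec (q ≡ q)
      all? q = q ≟ q
      all≡ : cnt all? (suc p) ≡ suc p
      all≡ = cnt-full all? (suc p) (λ _ _ → refl)
      crowded : cnt all? (suc p) ≤ # (used p) n
      crowded = cnt-injection all? (λ q → used p q Bool.≟ true) (suc p) n ρ
        (λ q q≤p _ → ρ< (<-≤-trans q≤p p<n) , Bool.¬-not λ u → none (ρ q , ρ< (<-≤-trans q≤p p<n) ,
           ≤-trans (prefixMin-antitone ρ (≤-pred q≤p)) (prefixMin≤ ρ q) , u))
        (λ q r q≤p r≤p _ _ → ρ-injective (<-≤-trans q≤p p<n) (<-≤-trans r≤p p<n))

    pick-spec : ∀ p {r} → r < n → low p ≤ r → used p r ≡ false →
      used p (pick p) ≡ false × low p ≤ pick p × pick p ≤ r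
    pick-spec p {r} r<n low≤r u = firstUnused-spec (used p) n u low≤r (<-≤-trans r<n (m≤n+m n (low p)))

    pick-least : ∀ p {r} → r < n → low p ≤ r → used p r ≡ false → pick p ≤ r
    pick-least p r<n low≤r u = proj₂ (proj₂ (pick-spec p r<n low≤r u))

    low≤pick : ∀ {p} → p < n → low p ≤ pick p
    low≤pick {p} p<n = let r , r<n , low≤r , u = available p<n in proj₁ (proj₂ (pick-spec p r<n low≤r u))

    pick< : ∀ {p} → p < n → pick p < n
    pick< {p} p<n = let r , r<n , low≤r , u = available p<n in ≤-<-trans (pick-least p r<n low≤r u) r<n

    pick-fresh : ∀ {p p₀} → p < n → p₀ < p → pick p₀ ≢ pick p
    pick-fresh {p} p<n p₀<p e = case trans (sym (⇒used p p₀<p)) (trans (cong (used p) e) (proj₁ (pick-spec p r<n low≤r u))) of λ ()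
      where
      r = proj₁ (available p<n)
      r<n = proj₁ (proj₂ (available p<n))
      low≤r = proj₁ (proj₂ (proj₂ (available p<n)))
      u = proj₂ (proj₂ (proj₂ (available p<n)))

    pick-injective : ∀ {p q} → p < n → q < n → pick p ≡ pick q → p ≡ q
    pick-injective {p} {q} p<n q<n e with <-cmp p q
    ... | tri< p<q _ _ = contradiction e (pick-fresh q<n p<q)
    ... | tri≈ _ p≡q _ = p≡q
    ... | tri> _ _ q<p = contradiction (sym e) (pick-fresh p<n q<p)

    -- At `b` the value `pick c` is still free and, exceeding `pick a`, is above the current
    -- minimum; the least choice at `b` cannot be larger.
    pick-avoids132 : Avoids132 n pick
    pick-avoids132 {a} {b} {c} a<b b<c c<n a<c′ c<b′ = <⇒≱ c<b′ (pick-least b (pick< c<n)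
      (≤-trans (prefixMin-antitone ρ (<⇒≤ a<b)) (≤-trans (low≤pick (<-trans a<b (<-trans b<c c<n))) (<⇒≤ a<c′)))
      (Bool.¬-not λ u → let p₀ , p₀<b , e = used⇒ b u in pick-fresh c<n (<-trans p₀<b b<c) e))

    -- A new minimum of `ρ` is below all earlier minima, hence below all earlier picks, so it is
    -- free and picked at once. Thus `pick` inherits the prefix minima of `ρ`.
    low-picked : ∀ {p} → p < n → ∃ λ p₀ → p₀ ≤ p × pick p₀ ≡ low p
    low-picked {zero}  0<n = 0 , z≤n , ≤-antisym (pick-least 0 (ρ< 0<n) ≤-refl refl) (low≤pick 0<n)
    low-picked {suc p} p<n with low p ≤? ρ (suc p)
    ... | yes le = let p₀ , p₀≤p , e = low-picked (<-trans (n<1+n p) p<n) in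
                   p₀ , m≤n⇒m≤1+n p₀≤p , trans e (sym (m≤n⇒m⊓n≡m le))
    ... | no ≰ = suc p , ≤-refl , ≤-antisym (pick-least (suc p) (≤-<-trans (prefixMin≤ ρ (suc p)) (ρ< p<n)) ≤-refl
                   (Bool.¬-not λ u → let p₀ , p₀<1+p , e = used⇒ (suc p) u in
                     <⇒≱ (≰⇒> ≰) (≤-trans (prefixMin-antitone ρ (≤-pred p₀<1+p))
                       (≤-trans (low≤pick (<-trans p₀<1+p p<n)) (≤-reflexive (trans e (m≥n⇒m⊓n≡n (<⇒≤ (≰⇒> ≰)))))))))
                   (low≤pick p<n)

    prefixMin-pick : ∀ {p} → p < n → prefixMin pick p ≡ low p
    prefixMin-pick {p} p<n with prefixMin-attained pick p | low-picked p<n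
    ... | p₀ , p₀≤p , e₀ | p₁ , p₁≤p , e₁ = ≤-antisym
      (≤-trans (prefixMin-antitone pick p₁≤p) (≤-trans (prefixMin≤ pick p₁) (≤-reflexive e₁)))
      (≤-trans (prefixMin-antitone ρ p₀≤p) (≤-trans (low≤pick (≤-<-trans p₀≤p p<n)) (≤-reflexive e₀)))

Avoids123 : ℕ → (ℕ → ℕ) → Set
Avoids123 n σ = ∀ {a b c} → a < b → b < c → c < n → σ a < σ b → σ b < σ c → ⊥

-- If `ρ′ p` is the minimum so far, the equality of minima gives `ρ′ p ≤ ρ p`. Otherwise that
-- minimum stands at an earlier `p₀`; the value `ρ′ p` occurs in `ρ` only after `p`, and the entries
-- at `p₀`, `p` and there form a 123.
minima-no-rise : ∀ {n ρ τ ρ′} → IsPermutation n ρ τ → Avoids123 n ρ → (∀ {p} → p < n → ρ′ p < n) →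
  (∀ {p q} → p < n → q < n → ρ′ p ≡ ρ′ q → p ≡ q) → (∀ {p} → p < n → prefixMin ρ p ≡ prefixMin ρ′ p) →
  ∀ {p} → p < n → (∀ {p₀} → p₀ < p → ρ p₀ ≡ ρ′ p₀) → ρ p < ρ′ p → ⊥
minima-no-rise {n} {ρ} {τ} {ρ′} π av ρ′< ρ′-injective same {p} p<n prefix rise
  with prefixMin-attained ρ′ p
... | p₀ , p₀≤p , e₀ with m≤n⇒m<n∨m≡n p₀≤p
...   | inj₂ refl = <⇒≱ rise (≤-trans (≤-reflexive (trans e₀ (sym (same p<n)))) (prefixMin≤ ρ p))
...   | inj₁ p₀<p = av p₀<p p<c (τ< (ρ′< p<n)) lower (subst (ρ p <_) (sym (στ (ρ′< p<n))) rise)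
  where
  open IsPermutation π
  c = τ (ρ′ p)
  lower : ρ p₀ < ρ p
  lower = ≤∧≢⇒< (≤-trans (≤-reflexive (trans (prefix p₀<p) (trans e₀ (sym (same p<n))))) (prefixMin≤ ρ p))
            λ e → <⇒≢ p₀<p (σ-injective (<-trans p₀<p p<n) p<n e)
  p<c : p < c
  p<c = ≰⇒> λ c≤p → [ (λ c<p → <⇒≢ c<p (ρ′-injective (<-trans c<p p<n) p<n (trans (sym (prefix c<p)) (στ (ρ′< p<n)))))
                    , (λ c≡p → <⇒≢ rise (trans (cong ρ (sym c≡p)) (στ (ρ′< p<n)))) ]′ (m≤n⇒m<n∨m≡n c≤p)

minima-determine : ∀ {n ρ τ ρ′ τ′} → IsPermutation n ρ τ → IsPermutation n ρ′ τ′ → Avoids123 n ρ → Avoids123 n ρ′ →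
  (∀ {p} → p < n → prefixMin ρ p ≡ prefixMin ρ′ p) → ∀ {p} → p < n → ρ p ≡ ρ′ p
minima-determine π π′ av av′ same = first-difference
  (minima-no-rise π av (σ< π′) (σ-injective π′) same)
  (λ p<n prefix → minima-no-rise π′ av′ (σ< π) (σ-injective π) (λ q<n → sym (same q<n)) p<n (λ p₀<p → sym (prefix p₀<p)))
  where open IsPermutation

complement : ℕ → (ℕ → ℕ) → ℕ → ℕ
complement n σ p = n ∸ suc (σ p)

flip-flip : ∀ {n q} → q < n → n ∸ suc (n ∸ suc q) ≡ q
flip-flip {suc n} {q} q<n = m∸[m∸n]≡n (≤-pred q<n)

flip< : ∀ {n q} → q < n → n ∸ suc q < n
flip< {suc n} {q} _ = s≤s (m∸n≤m n q)

complement-permutation : ∀ {n σ τ} → IsPermutation n σ τ → IsPermutation n (complement n σ) (λ q → τ (n ∸ suc q))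
complement-permutation {n} {σ} {τ} π = record
  { σ< = λ p<n → flip< (σ< p<n)
  ; τ< = λ q<n → τ< (flip< q<n)
  ; τσ = λ p<n → trans (cong τ (flip-flip (σ< p<n))) (τσ p<n)
  ; στ = λ q<n → trans (cong (λ z → n ∸ suc z) (στ (flip< q<n))) (flip-flip q<n)
  }
  where open IsPermutation π

complement-avoids123 : ∀ {n σ} → (∀ {p} → p < n → σ p < n) → Avoids321 n σ → Avoids123 n (complement n σ)
complement-avoids123 {n} {σ} σ< av {a} {b} {c} a<b b<c c<n up₁ up₂ =
  av a<b b<c c<n (reflect up₁) (reflect up₂)
  where
  reflect : ∀ {x y} → n ∸ suc x < n ∸ suc y → y < x
  reflect {x} {y} lt = ≰⇒> λ x≤y → <⇒≱ lt (∸-monoʳ-≤ n (s≤s x≤y))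

-- Complementation turns 321 into 123, and the greedy filling turns a 123-avoider into the
-- 132-avoider with the same left-to-right minima. The map serves to compare the sizes of the two
-- classes.
simionSchmidt : ℕ → (ℕ → ℕ) → ℕ → ℕ
simionSchmidt n σ = Greedy.pick n (complement n σ)

simionSchmidt-injective : ∀ {n σ τ σ′ τ′} → IsPermutation n σ τ → IsPermutation n σ′ τ′ → Avoids321 n σ → Avoids321 n σ′ →
  (∀ {p} → p < n → simionSchmidt n σ p ≡ simionSchmidt n σ′ p) → ∀ {p} → p < n → σ p ≡ σ′ p
simionSchmidt-injective {n} {σ} {σ′ = σ′} π π′ av av′ same {p} p<n =
  trans (sym (flip-flip (σ< π p<n))) (trans (cong (λ z → n ∸ suc z) complements≡) (flip-flip (σ< π′ p<n)))
  where
  open IsPermutation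
  ρ  = complement-permutation π
  ρ′ = complement-permutation π′
  complements≡ : complement n σ p ≡ complement n σ′ p
  complements≡ = minima-determine ρ ρ′ (complement-avoids123 (σ< π) av) (complement-avoids123 (σ< π′) av′)
    (λ q<n → trans (sym (Greedy.prefixMin-pick n (complement n σ) (σ< ρ) (σ-injective ρ) q<n))
      (trans (prefixMin-cong same q<n) (Greedy.prefixMin-pick n (complement n σ′) (σ< ρ′) (σ-injective ρ′) q<n))) p<n

-- One-line vectors

module _ {n : ℕ} where

  -- 0 outside [0 , n).
  toFun : Vec (Fin n) n → ℕ → ℕ
  toFun σ p with p <? n
  ... | yes p<n = toℕ (lookup σ (fromℕ< p<n))
  ... | no _    = 0

  toFun-val : ∀ σ (i : Fin n) → toFun σ (toℕ i) ≡ val σ i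
  toFun-val σ i with toℕ i <? n
  ... | yes lt = cong (val σ) (fromℕ<-toℕ i lt)
  ... | no ≮   = contradiction (toℕ<n i) ≮

  toFun-fromℕ< : ∀ σ {p} (p<n : p < n) → toFun σ p ≡ val σ (fromℕ< p<n)
  toFun-fromℕ< σ p<n = trans (cong (toFun σ) (sym (toℕ-fromℕ< p<n))) (toFun-val σ (fromℕ< p<n))

  toFun< : ∀ σ {p} → p < n → toFun σ p < n
  toFun< σ p<n = subst (_< n) (sym (toFun-fromℕ< σ p<n)) (toℕ<n _)

  toFun-injective : ∀ σ σ′ → (∀ {p} → p < n → toFun σ p ≡ toFun σ′ p) → σ ≡ σ′
  toFun-injective σ σ′ same = trans (sym (tabulate∘lookup σ)) (trans (tabulate-cong λ i →
    toℕ-injective (trans (sym (toFun-val σ i)) (trans (same (toℕ<n i)) (toFun-val σ′ i)))) (tabulate∘lookup σ′))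

  fromFun : (f : ℕ → ℕ) → (∀ {p} → p < n → f p < n) → Vec (Fin n) n
  fromFun f f< = tabulate λ i → fromℕ< (f< (toℕ<n i))

  toFun-fromFun : ∀ f (f< : ∀ {p} → p < n → f p < n) {p} → p < n → toFun (fromFun f f<) p ≡ f p
  toFun-fromFun f f< {p} p<n = begin
    toFun (fromFun f f<) p                  ≡⟨ toFun-fromℕ< (fromFun f f<) p<n ⟩
    toℕ (lookup (fromFun f f<) (fromℕ< p<n)) ≡⟨ cong toℕ (lookup∘tabulate (λ i → fromℕ< (f< (toℕ<n i))) (fromℕ< p<n)) ⟩
    toℕ (fromℕ< (f< (toℕ<n (fromℕ< p<n))))  ≡⟨ toℕ-fromℕ< _ ⟩
    f (toℕ (fromℕ< p<n))                    ≡⟨ cong f (toℕ-fromℕ< p<n) ⟩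
    f p                                     ∎
    where open ≡-Reasoning

-- Boolean tests and lists

all-tabulate⇒ : ∀ {n} {A : Set} (P : A → Bool) (g : Fin n → A) → all P (List.tabulate g) ≡ true → ∀ i → P (g i) ≡ true
all-tabulate⇒ P g e Fin.zero with P (g Fin.zero)
... | true = refl
all-tabulate⇒ P g e (Fin.suc i) with P (g Fin.zero)
... | true = all-tabulate⇒ P (g ∘ Fin.suc) e i

⇒all-tabulate : ∀ {n} {A : Set} (P : A → Bool) (g : Fin n → A) → (∀ i → P (g i) ≡ true) → all P (List.tabulate g) ≡ true
⇒all-tabulate {zero}  P g h = refl
⇒all-tabulate {suc n} P g h rewrite h Fin.zero = ⇒all-tabulate P (g ∘ Fin.suc) (h ∘ Fin.suc)

any-tabulate⇒ : ∀ {n} {A : Set} (P : A → Bool) (g : Fin n → A) → any P (List.tabulate g) ≡ false → ∀ i → P (g i) ≡ false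
any-tabulate⇒ P g e Fin.zero with P (g Fin.zero)
... | false = refl
any-tabulate⇒ P g e (Fin.suc i) with P (g Fin.zero)
... | false = any-tabulate⇒ P (g ∘ Fin.suc) e i

⇒any-tabulate : ∀ {n} {A : Set} (P : A → Bool) (g : Fin n → A) → (∀ i → P (g i) ≡ false) → any P (List.tabulate g) ≡ false
⇒any-tabulate {zero}  P g h = refl
⇒any-tabulate {suc n} P g h rewrite h Fin.zero = ⇒any-tabulate P (g ∘ Fin.suc) (h ∘ Fin.suc)

not-true : ∀ {x} → not x ≡ true → x ≡ false
not-true {false} _ = refl

fromDoes-false : ∀ {A : Set} (a? : Dec A) → does a? ≡ false → ¬ A
fromDoes-false (no ¬a) _ = ¬a

implies⇒ : ∀ {x y} → not x ∨ y ≡ true → x ≡ true → y ≡ true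
implies⇒ e refl = e

⇒implies : ∀ {x y} → (x ≡ true → y ≡ true) → not x ∨ y ≡ true
⇒implies {true}  h = h refl
⇒implies {false} h = refl

T⇒≡true : ∀ {x} → T x → x ≡ true
T⇒≡true {true} _ = refl

≡true⇒T : ∀ {x} → x ≡ true → T x
≡true⇒T refl = _

∈⇒≤maximum : ∀ {x} xs → x ∈ xs → x ≤ maximum xs
∈⇒≤maximum (x ∷ xs) (here refl) = m≤m⊔n x _
∈⇒≤maximum (x ∷ xs) (there y∈)  = ≤-trans (∈⇒≤maximum xs y∈) (m≤n⊔m x _)

maximum≤ : ∀ {k} xs → (∀ {x} → x ∈ xs → x ≤ k) → maximum xs ≤ k
maximum≤ []       h = z≤n
maximum≤ (x ∷ xs) h = ⊔-lub (h (here refl)) (maximum≤ xs (h ∘ there))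

maximum≡ : ∀ {k xs} → k ∈ xs → (∀ {x} → x ∈ xs → x ≤ k) → maximum xs ≡ k
maximum≡ {xs = xs} k∈ h = ≤-antisym (maximum≤ xs h) (∈⇒≤maximum xs k∈)

any³⇒ : ∀ {n} (R : Fin n → Fin n → Fin n → Bool) →
  any (λ a → any (λ b → any (R a b) (allFin n)) (allFin n)) (allFin n) ≡ false → ∀ a b c → R a b c ≡ false
any³⇒ R e a b c = any-tabulate⇒ (R a b) id (any-tabulate⇒ (λ b → any (R a b) (allFin _)) id
  (any-tabulate⇒ (λ a → any (λ b → any (R a b) (allFin _)) (allFin _)) id e a) b) c

⇒any³ : ∀ {n} (R : Fin n → Fin n → Fin n → Bool) → (∀ a b c → R a b c ≡ false) →
  any (λ a → any (λ b → any (R a b) (allFin n)) (allFin n)) (allFin n) ≡ false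
⇒any³ R h = ⇒any-tabulate (λ a → any (λ b → any (R a b) (allFin _)) (allFin _)) id λ a →
  ⇒any-tabulate (λ b → any (R a b) (allFin _)) id λ b → ⇒any-tabulate (R a b) id (h a b)

-- `cnt` peels the largest argument, lists over `Fin n` the smallest.
cnt-bottom : {P : ℕ → Set} (P? : ∀ p → Dec (P p)) (n : ℕ) → cnt P? (suc n) ≡ ⟦ does (P? 0) ⟧ + cnt (λ p → P? (suc p)) n
cnt-bottom P? zero    = refl
cnt-bottom P? (suc n) = begin
  ⟦ does (P? (suc n)) ⟧ + cnt P? (suc n)  ≡⟨ cong (⟦ does (P? (suc n)) ⟧ +_) (cnt-bottom P? n) ⟩
  ⟦ does (P? (suc n)) ⟧ + (⟦ does (P? 0) ⟧ + cnt (λ p → P? (suc p)) n)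
    ≡⟨ sym (+-assoc ⟦ does (P? (suc n)) ⟧ ⟦ does (P? 0) ⟧ _) ⟩
  ⟦ does (P? (suc n)) ⟧ + ⟦ does (P? 0) ⟧ + cnt (λ p → P? (suc p)) n
    ≡⟨ cong (_+ cnt (λ p → P? (suc p)) n) (+-comm ⟦ does (P? (suc n)) ⟧ ⟦ does (P? 0) ⟧) ⟩
  ⟦ does (P? 0) ⟧ + ⟦ does (P? (suc n)) ⟧ + cnt (λ p → P? (suc p)) n
    ≡⟨ +-assoc ⟦ does (P? 0) ⟧ ⟦ does (P? (suc n)) ⟧ _ ⟩
  ⟦ does (P? 0) ⟧ + cnt (λ p → P? (suc p)) (suc n) ∎
  where open ≡-Reasoning

length-filter : ∀ {n} {A : Set} {P : ℕ → Set} (P? : ∀ p → Dec (P p)) (f : A → Bool) (g : Fin n → A) →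
  (∀ i → f (g i) ≡ does (P? (toℕ i))) → length (filterᵇ f (List.tabulate g)) ≡ cnt P? n
length-filter {zero}  P? f g h = refl
length-filter {suc n} P? f g h = trans head (sym (cnt-bottom P? n))
  where
  rec = length-filter (λ p → P? (suc p)) f (g ∘ Fin.suc) (h ∘ Fin.suc)
  head : length (filterᵇ f (List.tabulate g)) ≡ ⟦ does (P? 0) ⟧ + cnt (λ p → P? (suc p)) n
  head rewrite sym (h Fin.zero) with f (g Fin.zero)
  ... | true  = cong suc rec
  ... | false = rec

module _ {n : ℕ} (σ : Vec (Fin n) n) where

  private
    f : ℕ → ℕ
    f = toFun σ

  fp≡ : fp σ ≡ cnt (λ p → f p ≟ p) n
  fp≡ = length-filter (λ p → f p ≟ p) _ id λ i → cong (λ z → does (z ≟ toℕ i)) (sym (toFun-val σ i))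

  exc≡cnt : exc σ ≡ cnt (λ p → p <? f p) n
  exc≡cnt = length-filter (λ p → p <? f p) _ id λ i → cong (λ z → does (toℕ i <? z)) (sym (toFun-val σ i))

  fin : ∀ {p} → p < n → Fin n
  fin p<n = fromℕ< p<n

  order : ∀ {p q} (p<n : p < n) (q<n : q < n) → p < q → toℕ (fin p<n) < toℕ (fin q<n)
  order p<n q<n = subst₂ _<_ (sym (toℕ-fromℕ< p<n)) (sym (toℕ-fromℕ< q<n))

  values : ∀ {p q} (p<n : p < n) (q<n : q < n) → f p < f q → val σ (fin p<n) < val σ (fin q<n)
  values p<n q<n = subst₂ _<_ (toFun-fromℕ< σ p<n) (toFun-fromℕ< σ q<n)

  values⁻¹ : ∀ a b → val σ a < val σ b → f (toℕ a) < f (toℕ b)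
  values⁻¹ a b = subst₂ _<_ (sym (toFun-val σ a)) (sym (toFun-val σ b))

  distinct : isPerm σ ≡ true → ∀ {p q} → p < n → q < n → p < q → f p ≢ f q
  distinct e p<n q<n p<q fp≡fq = fromDoes-false (val σ i ≟ val σ j)
    (not-true (implies⇒ (all-tabulate⇒ (λ b → not (toℕ i <ᵇ toℕ b) ∨ not (val σ i ≡ᵇ val σ b)) id
      (all-tabulate⇒ (λ a → all (λ b → not (toℕ a <ᵇ toℕ b) ∨ not (val σ a ≡ᵇ val σ b)) (allFin n)) id e i) j)
      (dec-true (toℕ i <? toℕ j) (order p<n q<n p<q))))
    (trans (sym (toFun-fromℕ< σ p<n)) (trans fp≡fq (toFun-fromℕ< σ q<n)))
    where
    i = fin p<n
    j = fin q<n

  isPerm⇒ : isPerm σ ≡ true → ∀ {p q} → p < n → q < n → f p ≡ f q → p ≡ q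
  isPerm⇒ e {p} {q} p<n q<n fp≡fq with <-cmp p q
  ... | tri≈ _ p≡q _ = p≡q
  ... | tri< p<q _ _ = ⊥-elim (distinct e p<n q<n p<q fp≡fq)
  ... | tri> _ _ q<p = ⊥-elim (distinct e q<n p<n q<p (sym fp≡fq))

  ⇒isPerm : (∀ {p q} → p < n → q < n → f p ≡ f q → p ≡ q) → isPerm σ ≡ true
  ⇒isPerm inj = ⇒all-tabulate (λ a → all (λ b → not (toℕ a <ᵇ toℕ b) ∨ not (val σ a ≡ᵇ val σ b)) (allFin n)) id λ a →
    ⇒all-tabulate (λ b → not (toℕ a <ᵇ toℕ b) ∨ not (val σ a ≡ᵇ val σ b)) id λ b → ⇒implies λ a<b →
      cong not (dec-false (val σ a ≟ val σ b) λ va≡vb → <⇒≢ (fromDoes (toℕ a <? toℕ b) a<b)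
        (inj (toℕ<n a) (toℕ<n b) (trans (toFun-val σ a) (trans va≡vb (sym (toFun-val σ b))))))

  -- Nested like the conjunction in `contains132`, so that `does` computes to that test.
  pattern132? : ∀ a b c → Dec (toℕ a < toℕ b × toℕ b < toℕ c × val σ a < val σ c × val σ c < val σ b)
  pattern132? a b c = (toℕ a <? toℕ b) ×-dec (toℕ b <? toℕ c) ×-dec (val σ a <? val σ c) ×-dec (val σ c <? val σ b)

  pattern321? : ∀ a b c → Dec (toℕ a < toℕ b × toℕ b < toℕ c × val σ b < val σ a × val σ c < val σ b)
  pattern321? a b c = (toℕ a <? toℕ b) ×-dec (toℕ b <? toℕ c) ×-dec (val σ b <? val σ a) ×-dec (val σ c <? val σ b)

  avoids132⇒ : avoids132 σ ≡ true → Avoids132 n f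
  avoids132⇒ e {a} {b} {c} a<b b<c c<n fa<fc fc<fb = fromDoes-false (pattern132? (fin a<n) (fin b<n) (fin c<n))
    (any³⇒ (λ a b c → does (pattern132? a b c)) (not-true e) (fin a<n) (fin b<n) (fin c<n))
    (order a<n b<n a<b , order b<n c<n b<c , values a<n c<n fa<fc , values c<n b<n fc<fb)
    where
    b<n = <-trans b<c c<n
    a<n = <-trans a<b b<n

  ⇒avoids132 : Avoids132 n f → avoids132 σ ≡ true
  ⇒avoids132 av = cong not (⇒any³ (λ a b c → does (pattern132? a b c)) λ a b c →
    dec-false (pattern132? a b c) λ (a<b , b<c , va<vc , vc<vb) →
      av a<b b<c (toℕ<n c) (values⁻¹ a c va<vc) (values⁻¹ c b vc<vb))

  avoids321⇒ : avoids321 σ ≡ true → Avoids321 n f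
  avoids321⇒ e {a} {b} {c} a<b b<c c<n fb<fa fc<fb = fromDoes-false (pattern321? (fin a<n) (fin b<n) (fin c<n))
    (any³⇒ (λ a b c → does (pattern321? a b c)) (not-true e) (fin a<n) (fin b<n) (fin c<n))
    (order a<n b<n a<b , order b<n c<n b<c , values b<n a<n fb<fa , values c<n b<n fc<fb)
    where
    b<n = <-trans b<c c<n
    a<n = <-trans a<b b<n

  ⇒avoids321 : Avoids321 n f → avoids321 σ ≡ true
  ⇒avoids321 av = cong not (⇒any³ (λ a b c → does (pattern321? a b c)) λ a b c →
    dec-false (pattern321? a b c) λ (a<b , b<c , vb<va , vc<vb) →
      av a<b b<c (toℕ<n c) (values⁻¹ b a vb<va) (values⁻¹ c b vc<vb))

  rankCond⇔ : ∀ k → (rankCond σ k ≡ true → ∀ {p} → p < n → p < k → k ≤ f p) ×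
    ((∀ {p} → p < n → p < k → k ≤ f p) → rankCond σ k ≡ true)
  rankCond⇔ k = (λ e {p} p<n p<k → subst (k ≤_) (sym (toFun-fromℕ< σ p<n)) (≤-pred (fromDoes (k <? suc (val σ (fin p<n)))
      (implies⇒ (all-tabulate⇒ (λ a → not (toℕ a <ᵇ k) ∨ (k <ᵇ suc (val σ a))) id e (fin p<n))
        (dec-true (toℕ (fin p<n) <? k) (subst (_< k) (sym (toℕ-fromℕ< p<n)) p<k)))))) ,
    λ h → ⇒all-tabulate (λ a → not (toℕ a <ᵇ k) ∨ (k <ᵇ suc (val σ a))) id λ a → ⇒implies λ a<k →
      dec-true (k <? suc (val σ a)) (s≤s (subst (k ≤_) (toFun-val σ a) (h (toℕ<n a) (fromDoes (toℕ a <? k) a<k))))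

  rk≡ : ∀ {k} → k ≤ n → (∀ {p} → p < k → k ≤ f p) → (∀ {k′} → k′ ≤ n → (∀ p → p < k′ → k′ ≤ f p) → k′ ≤ k) → rk σ ≡ k
  rk≡ {k} k≤n holds largest = maximum≡ {xs = filterᵇ (rankCond σ) (upTo (suc n))}
    (∈-filter⁺ (T? ∘ rankCond σ) (∈-upTo⁺ (s≤s k≤n)) (≡true⇒T (proj₂ (rankCond⇔ k) (λ _ → holds))))
    (λ {k′} k′∈ → let k′∈upTo , c = ∈-filter⁻ (T? ∘ rankCond σ) {xs = upTo (suc n)} k′∈
                      k′≤n = ≤-pred (∈-upTo⁻ k′∈upTo) in
      largest k′≤n (λ p p<k′ → proj₁ (rankCond⇔ k′) (T⇒≡true c) (<-≤-trans p<k′ k′≤n) p<k′))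

-- Subsequences as sets of positions

select-list : (n : ℕ) (h : ℕ → ℕ) (S : ℕ → Bool) → List ℕ
select-list zero    h S = []
select-list (suc n) h S = if S 0 then h 0 ∷ select-list n (h ∘ suc) (S ∘ suc) else select-list n (h ∘ suc) (S ∘ suc)

length-select : ∀ n h S → length (select-list n h S) ≡ # S n
length-select zero    h S = refl
length-select (suc n) h S = trans head (sym (cnt-bottom (λ p → S p Bool.≟ true) n))
  where
  head : length (select-list (suc n) h S) ≡ ⟦ does (S 0 Bool.≟ true) ⟧ + # (S ∘ suc) n
  head with S 0
  ... | true  = cong suc (length-select n (h ∘ suc) (S ∘ suc))
  ... | false = length-select n (h ∘ suc) (S ∘ suc)

∈-select⁺ : ∀ n h S {q} → q < n → S q ≡ true → h q ∈ select-list n h S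
∈-select⁺ (suc n) h S {zero}  _   Sq rewrite Sq = here refl
∈-select⁺ (suc n) h S {suc q} q<n Sq with S 0
... | true  = there (∈-select⁺ n (h ∘ suc) (S ∘ suc) (≤-pred q<n) Sq)
... | false = ∈-select⁺ n (h ∘ suc) (S ∘ suc) (≤-pred q<n) Sq

∈-select⁻ : ∀ n h S {y} → y ∈ select-list n h S → ∃ λ q → q < n × S q ≡ true × y ≡ h q
∈-select⁻ (suc n) h S y∈ with S 0 in e
∈-select⁻ (suc n) h S (here refl) | true  = 0 , s≤s z≤n , e , refl
∈-select⁻ (suc n) h S (there y∈)  | true  =
  let q , q<n , Sq , eq = ∈-select⁻ n (h ∘ suc) (S ∘ suc) y∈ in suc q , s≤s q<n , Sq , eq
∈-select⁻ (suc n) h S y∈          | false =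
  let q , q<n , Sq , eq = ∈-select⁻ n (h ∘ suc) (S ∘ suc) y∈ in suc q , s≤s q<n , Sq , eq

increasing-tail : ∀ x xs → increasing (x ∷ xs) ≡ true → increasing xs ≡ true
increasing-tail x []       e = refl
increasing-tail x (y ∷ ys) e with x <ᵇ y
... | true = e

increasing-head : ∀ x xs → increasing (x ∷ xs) ≡ true → ∀ {y} → y ∈ xs → x < y
increasing-head x (y ∷ ys) e y′∈ with x <ᵇ y in x<y
increasing-head x (y ∷ ys) e (here refl) | true = fromDoes (x <? y) x<y
increasing-head x (y ∷ ys) e (there y′∈) | true = <-trans (fromDoes (x <? y) x<y) (increasing-head y ys e y′∈)

increasing-cons : ∀ x xs → (∀ {y} → y ∈ xs → x < y) → increasing xs ≡ true → increasing (x ∷ xs) ≡ true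
increasing-cons x []       h e = refl
increasing-cons x (y ∷ ys) h e rewrite dec-true (x <? y) (h (here refl)) = e

increasing-select⇒ : ∀ n h S → increasing (select-list n h S) ≡ true → IncreasingOn h n S
increasing-select⇒ (suc n) h S e {zero} {suc q} _ q<n Sp Sq rewrite Sp =
  increasing-head (h 0) _ e (∈-select⁺ n (h ∘ suc) (S ∘ suc) (≤-pred q<n) Sq)
increasing-select⇒ (suc n) h S e {suc p} {suc q} p<q q<n Sp Sq with S 0
... | true  = increasing-select⇒ n (h ∘ suc) (S ∘ suc) (increasing-tail (h 0) (select-list n (h ∘ suc) (S ∘ suc)) e) (≤-pred p<q) (≤-pred q<n) Sp Sq
... | false = increasing-select⇒ n (h ∘ suc) (S ∘ suc) e (≤-pred p<q) (≤-pred q<n) Sp Sq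

⇒increasing-select : ∀ n h S → IncreasingOn h n S → increasing (select-list n h S) ≡ true
⇒increasing-select zero    h S inc = refl
⇒increasing-select (suc n) h S inc with S 0 in S0
... | false = ⇒increasing-select n (h ∘ suc) (S ∘ suc) (λ p<q q<n → inc (s≤s p<q) (s≤s q<n))
... | true  = increasing-cons (h 0) _ (λ y∈ → let q , q<n , Sq , y≡ = ∈-select⁻ n (h ∘ suc) (S ∘ suc) y∈ in
                subst (h 0 <_) (sym y≡) (inc (s≤s z≤n) (s≤s q<n) S0 Sq))
                (⇒increasing-select n (h ∘ suc) (S ∘ suc) (λ p<q q<n → inc (s≤s p<q) (s≤s q<n)))

select∈subsequences : ∀ n h S → select-list n h S ∈ subsequences (applyUpTo h n)
select∈subsequences zero    h S = here refl
select∈subsequences (suc n) h S with S 0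
... | true  = ∈-++⁺ˡ (∈-map⁺ (h 0 ∷_) (select∈subsequences n (h ∘ suc) (S ∘ suc)))
... | false = ∈-++⁺ʳ (map (h 0 ∷_) (subsequences (applyUpTo (h ∘ suc) n))) (select∈subsequences n (h ∘ suc) (S ∘ suc))

cons : Bool → (ℕ → Bool) → ℕ → Bool
cons x S zero    = x
cons x S (suc p) = S p

subsequences-select : ∀ n h {xs} → xs ∈ subsequences (applyUpTo h n) → ∃ λ S → xs ≡ select-list n h S
subsequences-select zero    h (here refl) = (λ _ → false) , refl
subsequences-select (suc n) h xs∈ with ∈-++⁻ (map (h 0 ∷_) (subsequences (applyUpTo (h ∘ suc) n))) xs∈
... | inj₂ xs∈′ = let S , e = subsequences-select n (h ∘ suc) xs∈′ in cons false S , e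
... | inj₁ xs∈′ with ∈-map⁻ (h 0 ∷_) xs∈′
...   | ys , ys∈ , refl = let S , e = subsequences-select n (h ∘ suc) ys∈ in cons true S , cong (h 0 ∷_) e

map-val : ∀ {n} (g : Fin n → ℕ) (h : ℕ → ℕ) → (∀ i → h (toℕ i) ≡ g i) → List.tabulate g ≡ applyUpTo h n
map-val {zero}  g h e = refl
map-val {suc n} g h e = cong₂ _∷_ (sym (e Fin.zero)) (map-val (g ∘ Fin.suc) (h ∘ suc) (e ∘ Fin.suc))

-- The members of `subsequences` are exactly the selections along Boolean sets; length and increase
-- translate, so the two halves of `Longest` bound and attain the maximum.
lis≡ : ∀ {n k} (σ : Vec (Fin n) n) → Longest (toFun σ) n k → lis σ ≡ k
lis≡ {n} {k} σ L = trans (cong (λ w → maximum (map length (filterᵇ increasing (subsequences w)))) word≡)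
  (maximum≡ {xs = map length (filterᵇ increasing subs)} k∈ bounded)
  where
  h = toFun σ
  subs = subsequences (applyUpTo h n)
  word≡ : word σ ≡ applyUpTo h n
  word≡ = trans (map-tabulate id (val σ)) (map-val (val σ) h (toFun-val σ))
  bounded : ∀ {m} → m ∈ map length (filterᵇ increasing subs) → m ≤ k
  bounded m∈ with ∈-map⁻ length m∈
  ... | xs , xs∈ , refl with ∈-filter⁻ (T? ∘ increasing) {xs = subs} xs∈
  ...   | xs∈′ , inc with subsequences-select n h xs∈′
  ...     | S , refl = ≤-trans (≤-reflexive (length-select n h S))
                         (Longest.upper L S (increasing-select⇒ n h S (T⇒≡true inc)))
  S = proj₁ (Longest.witness L)
  S-inc = proj₁ (proj₂ (Longest.witness L))
  k∈ : k ∈ map length (filterᵇ increasing subs)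
  k∈ = subst (_∈ map length (filterᵇ increasing subs))
    (trans (length-select n h S) (≤-antisym (Longest.upper L S S-inc) (proj₂ (proj₂ (Longest.witness L)))))
    (∈-map⁺ length (∈-filter⁺ (T? ∘ increasing) (select∈subsequences n h S) (≡true⇒T (⇒increasing-select n h S S-inc))))

-- The bijection

agreeing-avoids132 : ∀ {n f g} → (∀ {p} → p < n → f p ≡ g p) → Avoids132 n g → Avoids132 n f
agreeing-avoids132 same av a<b b<c c<n fa<fc fc<fb = av a<b b<c c<n
  (subst₂ _<_ (same (<-trans a<b (<-trans b<c c<n))) (same c<n) fa<fc)
  (subst₂ _<_ (same c<n) (same (<-trans b<c c<n)) fc<fb)

agreeing-avoids321 : ∀ {n f g} → (∀ {p} → p < n → f p ≡ g p) → Avoids321 n g → Avoids321 n f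
agreeing-avoids321 same av a<b b<c c<n fb<fa fc<fb = av a<b b<c c<n
  (subst₂ _<_ (same (<-trans b<c c<n)) (same (<-trans a<b (<-trans b<c c<n))) fb<fa)
  (subst₂ _<_ (same c<n) (same (<-trans b<c c<n)) fc<fb)

agreeing-increasing : ∀ {n f g S} → (∀ {p} → p < n → f p ≡ g p) → IncreasingOn g n S → IncreasingOn f n S
agreeing-increasing same inc p<q q<n Sp Sq = subst₂ _<_ (sym (same (<-trans p<q q<n))) (sym (same q<n)) (inc p<q q<n Sp Sq)

agreeing-longest : ∀ {n f g k} → (∀ {p} → p < n → f p ≡ g p) → Longest g n k → Longest f n k
agreeing-longest same L = record
  { upper   = λ S inc → Longest.upper L S (agreeing-increasing (λ p<n → sym (same p<n)) inc)
  ; witness = let S , inc , k≤ = Longest.witness L in S , agreeing-increasing same inc , k≤ }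

wordOf : ∀ {n σ τ} → IsPermutation n σ τ → Avoids132 n σ → Word n
wordOf π av = record
  { a = a ; b = b ; P = P ; V = V ; X = x ; Y = y ; G = G ; step = step
  ; a-start = a-start ; b-start = b-start ; a-end = proj₁ (proj₂ final) ; b-end = proj₁ final }
  where open Statistics π av

permutationOf : ∀ {n} (v : Vec (Fin n) n) → isPerm v ≡ true → IsPermutation n (toFun v) (preimage n (toFun v))
permutationOf {n} v perm = injection⇒permutation n (toFun v) (toFun< v) (isPerm⇒ v perm)

module Transfer {n : ℕ} (v : Vec (Fin n) n) (perm : isPerm v ≡ true) (av : avoids132 v ≡ true) where
  π : IsPermutation n (toFun v) (preimage n (toFun v))
  π = permutationOf v perm

  W : Word n
  W = wordOf π (avoids132⇒ v av)

  module S = Statistics π (avoids132⇒ v av)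
  module D = Decode W
  open IsPermutation D.permutation

  abstract
    image : Vec (Fin n) n
    image = fromFun D.σ σ<

    agrees : ∀ {p} → p < n → toFun image p ≡ D.σ p
    agrees = toFun-fromFun D.σ σ<

  image-isPerm : isPerm image ≡ true
  image-isPerm = ⇒isPerm image λ p<n q<n e → σ-injective p<n q<n (trans (sym (agrees p<n)) (trans e (agrees q<n)))

  image-avoids321 : avoids321 image ≡ true
  image-avoids321 = ⇒avoids321 image (agreeing-avoids321 agrees D.σ-avoids321)

  image-fp : fp image ≡ fp v
  image-fp = begin
    fp image                               ≡⟨ fp≡ image ⟩
    cnt (λ p → toFun image p ≟ p) n        ≡⟨ cnt-ext (λ p → toFun image p ≟ p) (λ p → D.σ p ≟ p) n
                                                (λ p p<n → trans (sym (agrees p<n))) (λ p p<n → trans (agrees p<n)) ⟩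
    cnt (λ p → D.σ p ≟ p) n                ≡⟨ D.fixed-count ⟩
    cnt (λ t → S.G t Bool.≟ true) n        ≡⟨ sym S.fix≡ ⟩
    cnt (λ p → toFun v p ≟ p) n            ≡⟨ sym (fp≡ v) ⟩
    fp v                                   ∎
    where open ≡-Reasoning

  image-exc : exc image ≡ exc v
  image-exc = begin
    exc image                              ≡⟨ exc≡cnt image ⟩
    cnt (λ p → p <? toFun image p) n       ≡⟨ cnt-ext (λ p → p <? toFun image p) (λ p → p <? D.σ p) n
                                                (λ p p<n → subst (p <_) (agrees p<n)) (λ p p<n → subst (p <_) (sym (agrees p<n))) ⟩
    cnt (λ p → p <? D.σ p) n               ≡⟨ D.exc-count ⟩
    cnt (λ t → S.V t Bool.≟ true) n        ≡⟨ sym S.exc≡ ⟩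
    cnt (λ p → p <? toFun v p) n           ≡⟨ sym (exc≡cnt v) ⟩
    exc v                                  ∎
    where open ≡-Reasoning

  module R = Walk n (toFun v)

  rk≤n : R.walk n ≤ n
  rk≤n = R.walk≤ n

  rk-walk : rk v ≡ R.walk n
  rk-walk = rk≡ v rk≤n (λ p<i → ≤-trans (≤-reflexive (sym R.top-end)) (R.above n ≤-refl p<i)) R.rank-maximal

  -- After `n` steps the longest length is the number of steps without a turn, and the turns number
  -- `R.walk n`.
  lis-walk : lis image ≡ n ∸ R.walk n
  lis-walk = trans (lis≡ image (agreeing-longest agrees (proj₁ (Length.longest W n ≤-refl)))) (begin
    #¬X                        ≡⟨ sym (m+n∸m≡n #X #¬X) ⟩
    #X + #¬X ∸ #X              ≡⟨ cong₂ _∸_ (cnt-bool S.x n) #X≡walk ⟩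
    n ∸ R.walk n               ∎)
    where
    open ≡-Reasoning
    #X #¬X : ℕ
    #X  = cnt (λ t → S.x t Bool.≟ true) n
    #¬X = cnt (λ t → S.x t Bool.≟ false) n
    #X≡walk : #X ≡ R.walk n
    #X≡walk = trans (cnt-ext (λ t → S.x t Bool.≟ true) R.turn? n (λ t _ → fromDoes (R.turn? t)) (λ t _ → dec-true (R.turn? t)))
                (sym (R.walk-cnt n))

-- The image determines the turns of both walks, and these determine a 132-avoider.
transfer-injective : ∀ {n} (v v′ : Vec (Fin n) n) (perm : isPerm v ≡ true) (av : avoids132 v ≡ true)
  (perm′ : isPerm v′ ≡ true) (av′ : avoids132 v′ ≡ true) →
  Transfer.image v perm av ≡ Transfer.image v′ perm′ av′ → v ≡ v′
transfer-injective {n} v v′ perm av perm′ av′ e = toFun-injective v v′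
  (turns-determine T.π T′.π (avoids132⇒ v av) (avoids132⇒ v′ av′)
    (λ t t<n → proj₁ (proj₂ (I.same-step t t<n))) (λ t t<n → proj₂ (proj₂ (I.same-step t t<n)))
    (proj₂ (proj₂ T.S.final)) (proj₂ (proj₂ T′.S.final)))
  where
  module T  = Transfer v perm av
  module T′ = Transfer v′ perm′ av′
  module I  = DecodeInjective T.W T′.W
    (λ {p} p<n → trans (sym (T.agrees p<n)) (trans (cong (λ u → toFun u p) e) (T′.agrees p<n)))

module Back {n : ℕ} (v : Vec (Fin n) n) (perm : isPerm v ≡ true) (av : avoids321 v ≡ true) where
  π : IsPermutation n (toFun v) (preimage n (toFun v))
  π = permutationOf v perm

  open Greedy n (complement n (toFun v)) using (pick)
  ρ = complement-permutation π
  module G = Greedy n (complement n (toFun v))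

  pick<n : ∀ {p} → p < n → pick p < n
  pick<n = G.pick< (IsPermutation.σ< ρ) (IsPermutation.σ-injective ρ)

  abstract
    image : Vec (Fin n) n
    image = fromFun pick pick<n

    agrees : ∀ {p} → p < n → toFun image p ≡ pick p
    agrees = toFun-fromFun pick pick<n

  image-isPerm : isPerm image ≡ true
  image-isPerm = ⇒isPerm image λ p<n q<n e → G.pick-injective (IsPermutation.σ< ρ) (IsPermutation.σ-injective ρ) p<n q<n
    (trans (sym (agrees p<n)) (trans e (agrees q<n)))

  image-avoids132 : avoids132 image ≡ true
  image-avoids132 = ⇒avoids132 image (agreeing-avoids132 agrees
    (G.pick-avoids132 (IsPermutation.σ< ρ) (IsPermutation.σ-injective ρ)))

back-injective : ∀ {n} (v v′ : Vec (Fin n) n) (perm : isPerm v ≡ true) (av : avoids321 v ≡ true)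
  (perm′ : isPerm v′ ≡ true) (av′ : avoids321 v′ ≡ true) →
  Back.image v perm av ≡ Back.image v′ perm′ av′ → v ≡ v′
back-injective v v′ perm av perm′ av′ e = toFun-injective v v′
  (simionSchmidt-injective B.π B′.π (avoids321⇒ v av) (avoids321⇒ v′ av′)
    (λ {p} p<n → trans (sym (B.agrees p<n)) (trans (cong (λ u → toFun u p) e) (B′.agrees p<n))))
  where
  module B  = Back v perm av
  module B′ = Back v′ perm′ av′

-- Injective self-maps of a finite set

module _ {A : Set} (e : A → A) where

  iterate : ℕ → A → A
  iterate zero    x = x
  iterate (suc k) x = e (iterate k x)

  module _ (e-injective : ∀ {x y} → e x ≡ e y → x ≡ y) {N : ℕ} (code : A → Fin N)
    (code-injective : ∀ {x y} → code x ≡ code y → x ≡ y) where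

    iterate-cancel : ∀ i d x → iterate i x ≡ iterate (i + d) x → x ≡ iterate d x
    iterate-cancel zero    d x eq = eq
    iterate-cancel (suc i) d x eq = iterate-cancel i d x (e-injective eq)

    abstract
      -- Two points of the orbit of x coincide, so x itself recurs.
      finite-injective⇒surjective : ∀ x → ∃ λ x₀ → e x₀ ≡ x
      finite-injective⇒surjective x with pigeonhole (n<1+n N) (λ i → code (iterate (toℕ i) x))
      ... | i , j , i<j , eq = iterate (pred d) x , sym (trans
              (iterate-cancel (toℕ i) d x (trans (code-injective eq) (cong (λ k → iterate k x) (sym (m+[n∸m]≡n (<⇒≤ i<j))))))
              (cong (λ k → iterate k x) (sym (suc-pred d {{>-nonZero (m<n⇒0<n∸m i<j)}}))))
        where
        d : ℕ
        d = toℕ j ∸ toℕ i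

Bool-irrelevant : {x y : Bool} (p q : x ≡ y) → p ≡ q
Bool-irrelevant = Decidable⇒UIP.≡-irrelevant Bool._≟_

Avoider321 : ℕ → Set
Avoider321 n = Σ (Vec (Fin n) n) λ v → isPerm v ≡ true × avoids321 v ≡ true

Avoider132 : ℕ → Set
Avoider132 n = Σ (Vec (Fin n) n) λ v → isPerm v ≡ true × avoids132 v ≡ true

avoider≡ : ∀ {n} {u u′ : Avoider321 n} → proj₁ u ≡ proj₁ u′ → u ≡ u′
avoider≡ {u = v , p , q} {.v , p′ , q′} refl = cong₂ (λ p q → v , p , q) (Bool-irrelevant p p′) (Bool-irrelevant q q′)

transfer : ∀ {n} → Avoider132 n → Avoider321 n
transfer (v , p , q) = T.image , T.image-isPerm , T.image-avoids321
  where module T = Transfer v p q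

back : ∀ {n} → Avoider321 n → Avoider132 n
back (v , p , q) = B.image , B.image-isPerm , B.image-avoids132
  where module B = Back v p q

abstract
  transfer∘back-injective : ∀ {n} (u u′ : Avoider321 n) → transfer (back u) ≡ transfer (back u′) → u ≡ u′
  transfer∘back-injective (v , p , q) (v′ , p′ , q′) e = avoider≡ (back-injective v v′ p q p′ q′
    (transfer-injective B.image B′.image B.image-isPerm B.image-avoids132 B′.image-isPerm B′.image-avoids132 (cong proj₁ e)))
    where
    module B  = Back v p q
    module B′ = Back v′ p′ q′

  code-injective : ∀ {n} (u u′ : Avoider321 n) → funToFin (lookup (proj₁ u)) ≡ funToFin (lookup (proj₁ u′)) → u ≡ u′
  code-injective {n} u u′ e = avoider≡ (toFun-injective (proj₁ u) (proj₁ u′) λ p<n →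
    trans (toFun-fromℕ< (proj₁ u) p<n) (trans (cong toℕ (trans (sym (finToFun-funToFin (lookup (proj₁ u)) (fromℕ< p<n)))
      (trans (cong (λ (c : Fin (n ^ n)) → finToFun c (fromℕ< p<n)) e) (finToFun-funToFin (lookup (proj₁ u′)) (fromℕ< p<n))))) (sym (toFun-fromℕ< (proj₁ u′) p<n))))

  -- `back` followed by `transfer` is an injective self-map of the finite class of 321-avoiders,
  -- hence onto.
  transfer-surjective : ∀ {n} (u : Avoider321 n) → ∃ λ u₀ → transfer u₀ ≡ u
  transfer-surjective {n} u = back (proj₁ found) , proj₂ found
    where
    found : ∃ λ u₀ → transfer (back u₀) ≡ u
    found = finite-injective⇒surjective (λ u → transfer (back u)) (λ {x} {y} → transfer∘back-injective x y)
      (λ u → funToFin (lookup (proj₁ u))) (λ {x} {y} → code-injective x y) u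

theorem2 : (n : ℕ) → 1 ≤ n → (i j k : ℕ) → i ≤ n → j ≤ n → k ≤ n →
    (Σ (Vec (Fin n) n) λ σ → isPerm σ ≡ true × avoids321 σ ≡ true × fp σ ≡ i × exc σ ≡ j × lis σ ≡ k)
    ↔ (Σ (Vec (Fin n) n) λ σ → isPerm σ ≡ true × avoids132 σ ≡ true × fp σ ≡ i × exc σ ≡ j × rk σ ≡ n ∸ k)
theorem2 n _ i j k _ _ k≤n = mk↔ₛ′ to from
  -- `from` is injective, so the one inverse law `from∘to` yields the other.
  (λ y → from-injective (from∘to (from y))) from∘to
  where
  A B : Set
  A = Σ (Vec (Fin n) n) λ σ → isPerm σ ≡ true × avoids321 σ ≡ true × fp σ ≡ i × exc σ ≡ j × lis σ ≡ k
  B = Σ (Vec (Fin n) n) λ σ → isPerm σ ≡ true × avoids132 σ ≡ true × fp σ ≡ i × exc σ ≡ j × rk σ ≡ n ∸ k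

  A≡ : ∀ {x y : A} → proj₁ x ≡ proj₁ y → x ≡ y
  A≡ {_ , p , q , r , s , t} {_ , p′ , q′ , r′ , s′ , t′} refl
    rewrite Bool-irrelevant p p′ | Bool-irrelevant q q′ | ≡-irrelevant r r′ | ≡-irrelevant s s′ | ≡-irrelevant t t′ = refl

  B≡ : ∀ {x y : B} → proj₁ x ≡ proj₁ y → x ≡ y
  B≡ {_ , p , q , r , s , t} {_ , p′ , q′ , r′ , s′ , t′} refl
    rewrite Bool-irrelevant p p′ | Bool-irrelevant q q′ | ≡-irrelevant r r′ | ≡-irrelevant s s′ | ≡-irrelevant t t′ = refl

  from : B → A
  from (v , p , q , fp≡i , exc≡j , rk≡n∸k) = T.image , T.image-isPerm , T.image-avoids321 ,
    trans T.image-fp fp≡i , trans T.image-exc exc≡j ,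
    -- Rank `n ∸ k` becomes length `n ∸ (n ∸ k)`, which is `k` because `k ≤ n`.
    trans T.lis-walk (trans (cong (n ∸_) (trans (sym T.rk-walk) rk≡n∸k)) (m∸[m∸n]≡n k≤n))
    where module T = Transfer v p q

  from-injective : ∀ {x y} → from x ≡ from y → x ≡ y
  from-injective {v , p , q , _} {v′ , p′ , q′ , _} e = B≡ (transfer-injective v v′ p q p′ q′ (cong proj₁ e))

  origin : (x : A) → ∃ λ u → proj₁ (transfer u) ≡ proj₁ x
  origin (v , p , q , _) = let u , e = transfer-surjective (v , p , q) in u , cong proj₁ e

  -- The preimage comes from surjectivity alone; it has the right statistics because `transfer`
  -- keeps `fp` and `exc` and turns rank into length.
  to : A → B
  to x@(v , p , q , fp≡i , exc≡j , lis≡k) = u , p′ , q′ ,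
    trans (sym T.image-fp) (trans (cong fp e) fp≡i) , trans (sym T.image-exc) (trans (cong exc e) exc≡j) ,
    trans T.rk-walk (trans (sym (m∸[m∸n]≡n T.rk≤n)) (cong (n ∸_) (trans (sym T.lis-walk) (trans (cong lis e) lis≡k))))
    where
    u  = proj₁ (proj₁ (origin x))
    p′ = proj₁ (proj₂ (proj₁ (origin x)))
    q′ = proj₂ (proj₂ (proj₁ (origin x)))
    e  = proj₂ (origin x)
    module T = Transfer u p′ q′

  from∘to : ∀ x → from (to x) ≡ x
  from∘to x = A≡ (proj₂ (origin x))
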